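{- Let $r\ge2$ and write the weight one vectorial Eisenstein series on $\Omega^r$ in coordinates as $\mathcal E_1=(\epsilon_r,\epsilon_{r-1},\dots,\epsilon_1)^{tr}$. Then for all $i=1,2,\dots,r$ and all $\bm z\in\Omega^r$ we have $\epsilon_i(\bm z)\ne0$ in $\mathbb{T}$. In particular, $\mathcal E_1$ is nowhere-vanishing on $\Omega^r$.
   Context: Let $\mathbb{F}_q$ be the finite field with $q$ elements, $A=\mathbb{F}_q[\theta]$, $K_\infty=\mathbb{F}_q((\theta^{ -1}))$, and $\mathbb{C}_\infty$ the completion of an algebraic closure of $K_\infty$, with absolute value normalized by $|\theta|=q$. $\mathbb{T}$ is the Tate algebra, the completion of $\mathbb{C}_\infty[t]$ for the Gauss norm $\|\sum f_it^i\|=\max|f_i|$. Let $\chi_t:A\to\mathbb{F}_q[t]\subset\mathbb{T}$ be the $\mathbb{F}_q$-algebra map $\theta\mapsto t$, and $\rho_t$ its entrywise extension to column vectors over $A$. $\Omega^r$ is the set of row vectors $\bm z=(z_r,z_{r-1},\dots,z_1)\in\mathbb{C}_\infty^r$ with $z_1=1$ and $z_1,\dots,z_r$ linearly independent over $K_\infty$. The weight one vectorial Eisenstein series $\mathcal E_1:\Omega^r\to\mathbb{T}^r$ is $\mathcal E_1(\bm z)=\sum_{0\ne\bm a\in A^r}(\bm z\bm a)^{ -1}\rho_t(\bm a)$, where $A^r$ and $\mathbb{T}^r$ consist of column vectors; thus, with $\bm a=(a_r,\dots,a_1)^{tr}$, $\epsilon_i(\bm z)=\sum_{0\ne\bm a\in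 A^r}(\bm z\bm a)^{ -1}\chi_t(a_i)$. The series converge in $\mathbb{T}$. -}

module Defs where

open import Level using (_⊔_) renaming (suc to lsuc)
open import Algebra.Bundles using (CommutativeRing)
open import Algebra.Morphism.Structures using (IsRingHomomorphism)
open import Data.Fin.Base using (Fin; toℕ)
open import Data.List.Base using (List; []; _∷_; map; foldr)
open import Data.List.Relation.Unary.All using (All)
open import Data.Nat.Base as ℕ using (ℕ; zero; suc)
import Data.Nat.Properties as ℕ
open import Data.Product.Base using (Σ-syntax; ∃-syntax; _×_; _,_; proj₁; proj₂)
open import Data.Rational.Base as ℚ using (ℚ; 1ℚ)
open import Data.Vec.Functional using (Vector)
open import Function.Bundles using (Inverse)
open import Relation.Binary.Bundles using (Setoid)
import Relation.Binary.Construct.Add.Infimum.NonStrict as AddInfimum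
import Relation.Binary.Construct.On as On
open import Relation.Binary.PropositionalEquality as ≡ using (_≡_)
open import Relation.Nullary.Construct.Add.Infimum using (_₋; ⊥₋; [_])
open import Relation.Nullary.Negation using (¬_)

open AddInfimum ℚ._≤_ public using (_≤₋_)

------------------------------------------------------------------------
-- Fields

-- The inverse is total; its value at 0 is unspecified and never used below.
record Field c ℓ : Set (lsuc (c ⊔ ℓ)) where
  infix 9 _⁻¹
  field
    commutativeRing : CommutativeRing c ℓ
  open CommutativeRing commutativeRing public
  field
    1≉0      : 1# ≉ 0#
    _⁻¹      : Carrier → Carrier
    inverseʳ : ∀ x → x ≉ 0# → x * x ⁻¹ ≈ 1#

record FiniteField c ℓ (q : ℕ) : Set (lsuc (c ⊔ ℓ)) where
  field
    fld         : Field c ℓ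
    enumeration : Inverse (Field.setoid fld) (≡.setoid (Fin q))
  open Field fld public

------------------------------------------------------------------------
-- Polynomials

-- The list c₀ ∷ c₁ ∷ … stands for c₀ + c₁X + …, trailing zeros being allowed;
-- hence _≈ᴾ_ compares coefficients and not lists.
module Polynomial {c ℓ} (R : CommutativeRing c ℓ) where
  open CommutativeRing R

  infix  4 _≈ᴾ_
  infixl 6 _+ᴾ_ _-ᴾ_

  Poly : Set c
  Poly = List Carrier

  coeff : Poly → ℕ → Carrier
  coeff []      _       = 0#
  coeff (c ∷ _) zero    = c
  coeff (_ ∷ p) (suc n) = coeff p n

  _≈ᴾ_ : Poly → Poly → Set ℓ
  p ≈ᴾ q = ∀ n → coeff p n ≈ coeff q n

  polySetoid : Setoid c ℓ
  polySetoid = record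
    { Carrier       = Poly
    ; _≈_           = _≈ᴾ_
    ; isEquivalence = record
      { refl  = λ _ → refl
      ; sym   = λ e n → sym (e n)
      ; trans = λ e f n → trans (e n) (f n)
      }
    }

  _+ᴾ_ : Poly → Poly → Poly
  []      +ᴾ q       = q
  (c ∷ p) +ᴾ []      = c ∷ p
  (c ∷ p) +ᴾ (d ∷ q) = (c + d) ∷ (p +ᴾ q)

  _-ᴾ_ : Poly → Poly → Poly
  p -ᴾ q = p +ᴾ map (-_) q

  scale : Carrier → Poly → Poly
  scale c = map (c *_)

  eval : Poly → Carrier → Carrier
  eval p x = foldr (λ c y → c + x * y) 0# p

  coeff-+ : ∀ p q n → coeff (p +ᴾ q) n ≈ coeff p n + coeff q n
  coeff-+ []      q       n       = sym (+-identityˡ _)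
  coeff-+ (c ∷ p) []      n       = sym (+-identityʳ _)
  coeff-+ (c ∷ p) (d ∷ q) zero    = refl
  coeff-+ (c ∷ p) (d ∷ q) (suc n) = coeff-+ p q n

  coeff-neg : ∀ p n → coeff (map (-_) p) n ≈ - coeff p n
  coeff-neg []      n       = sym -0#≈0#
    where open import Algebra.Properties.Ring ring using (-0#≈0#)
  coeff-neg (c ∷ p) zero    = refl
  coeff-neg (c ∷ p) (suc n) = coeff-neg p n

  coeff-- : ∀ p q n → coeff (p -ᴾ q) n ≈ coeff p n - coeff q n
  coeff-- p q n =
    trans (coeff-+ p (map (-_) q) n) (+-congˡ (coeff-neg q n))

------------------------------------------------------------------------
-- Non-archimedean valued fields

infixl 6 _+₋_

_+₋_ : ℚ ₋ → ℚ ₋ → ℚ ₋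
[ a ] +₋ [ b ] = [ a ℚ.+ b ]
[ _ ] +₋ ⊥₋    = ⊥₋
⊥₋    +₋ _     = ⊥₋

-- deg x = log_q |x|, with deg 0 = ⊥₋.  Rational values suffice: an algebraic
-- closure of 𝔽_q((θ⁻¹)) has value group q^ℚ, and completing a
-- non-archimedean field does not enlarge its value group.
record ValuedField c ℓ : Set (lsuc (c ⊔ ℓ)) where
  field
    fld : Field c ℓ
  open Field fld public
  field
    deg         : Carrier → ℚ ₋
    deg-cong    : ∀ {x y} → x ≈ y → deg x ≡ deg y
    deg-0       : deg 0# ≡ ⊥₋
    deg-⊥₋      : ∀ {x} → deg x ≡ ⊥₋ → x ≈ 0#
    deg-*       : ∀ x y → deg (x * y) ≡ deg x +₋ deg y
    ultrametric : ∀ {x y b} → deg x ≤₋ b → deg y ≤₋ b → deg (x + y) ≤₋ b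

  _⟶_ : (ℕ → Carrier) → Carrier → Set
  s ⟶ x = ∀ (B : ℚ) → ∃[ N ] ∀ n → N ℕ.≤ n → deg (s n - x) ≤₋ [ B ]

  Cauchy : (ℕ → Carrier) → Set
  Cauchy s =
    ∀ (B : ℚ) → ∃[ N ] ∀ m n → N ℕ.≤ m → N ℕ.≤ n → deg (s m - s n) ≤₋ [ B ]

------------------------------------------------------------------------
-- ℂ∞

-- A valued field containing 𝔽_q(θ), with |θ| = q.
record ValuedExtension {c ℓ q} (𝔽 : FiniteField c ℓ q) c′ ℓ′
       : Set (c ⊔ ℓ ⊔ lsuc (c′ ⊔ ℓ′)) where
  field
    valuedField : ValuedField c′ ℓ′
  open ValuedField valuedField public
  field
    ι     : FiniteField.Carrier 𝔽 → Carrier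
    ι-hom : IsRingHomomorphism (FiniteField.rawRing 𝔽) rawRing ι
    θ     : Carrier
    deg-θ : deg θ ≡ [ 1ℚ ]

  open import Algebra.Properties.Semiring.Exp semiring public using (_^_)
  open import Algebra.Properties.Semiring.Sum semiring public using (sum)
  open Polynomial commutativeRing public

  -- The image of 𝔽_q((θ⁻¹)): sums Σ_{j≥0} a_j θ^{m-j}.  Taking m ≥ 0 is no
  -- restriction, as leading coefficients may vanish.
  _∈K∞ : Carrier → Set c
  x ∈K∞ = Σ[ m ∈ ℕ ] Σ[ a ∈ (ℕ → FiniteField.Carrier 𝔽) ]
    (λ n → θ ^ m * sum {n} (λ j → ι (a (toℕ j)) * (θ ⁻¹) ^ toℕ j)) ⟶ x

  -- algebraic over K∞
  _∈K̄ : Carrier → Set (c ⊔ c′ ⊔ ℓ′)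
  x ∈K̄ = Σ[ p ∈ Poly ] All _∈K∞ p × (∃[ n ] coeff p n ≉ 0#) × eval p x ≈ 0#

-- ℂ∞ is described as a complete valued field in which the elements algebraic
-- over K∞ = 𝔽_q((θ⁻¹)) form an algebraically closed dense subfield K̄, i.e. as
-- the completion of an algebraic closure of K∞.  This determines ℂ∞ up to
-- isometric isomorphism.
record ℂ∞ {c ℓ q} (𝔽 : FiniteField c ℓ q) c′ ℓ′
       : Set (c ⊔ ℓ ⊔ lsuc (c′ ⊔ ℓ′)) where
  field
    extension : ValuedExtension 𝔽 c′ ℓ′
  open ValuedExtension extension public
  field
    K̄-algebraicallyClosed : ∀ p → All _∈K̄ p → (∃[ n ] coeff p (suc n) ≉ 0#) →
                            ∃[ x ] x ∈K̄ × eval p x ≈ 0#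
    K̄-dense  : ∀ x (B : ℚ) → ∃[ y ] y ∈K̄ × deg (x - y) ≤₋ [ B ]
    complete : ∀ s → Cauchy s → ∃[ x ] s ⟶ x

module Eisenstein {c ℓ q c′ ℓ′} {𝔽 : FiniteField c ℓ q} (C : ℂ∞ 𝔽 c′ ℓ′) where
  private module 𝔽 = FiniteField 𝔽
  open ℂ∞ C

  ----------------------------------------------------------------------
  -- The Tate algebra, as the completion of ℂ∞[t] by Cauchy sequences
  -- (only its additive group and norm are needed)

  -- Gauss norm at most q^B
  ‖_‖≤q^_ : Poly → ℚ → Set
  ‖ p ‖≤q^ B = ∀ n → deg (coeff p n) ≤₋ [ B ]

  record 𝕋 : Set c′ where
    field
      seq    : ℕ → Poly
      cauchy : ∀ (B : ℚ) → ∃[ N ] ∀ m n → N ℕ.≤ m → N ℕ.≤ n →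
               ‖ seq m -ᴾ seq n ‖≤q^ B
  open 𝕋

  -- ‖ s - t ‖ ≤ q^B in the completion.  The norms of the terms of a Cauchy
  -- sequence are eventually constant or tend to 0, so "eventually ≤ q^B" says
  -- that the limit of the norms is ≤ q^B.
  dist[_,_]≤q^_ : 𝕋 → 𝕋 → ℚ → Set
  dist[ s , t ]≤q^ B = ∃[ N ] ∀ n → N ℕ.≤ n → ‖ seq s n -ᴾ seq t n ‖≤q^ B

  infix 4 _≈ᵀ_ _≉ᵀ_

  _≈ᵀ_ _≉ᵀ_ : 𝕋 → 𝕋 → Set
  s ≈ᵀ t = ∀ B → dist[ s , t ]≤q^ B
  s ≉ᵀ t = ¬ s ≈ᵀ t

  fromPoly : Poly → 𝕋
  fromPoly p = record
    { seq    = λ _ → p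
    ; cauchy = λ B → 0 , λ _ _ _ _ n →
        ≡.subst (_≤₋ [ B ])
          (≡.sym (≡.trans (deg-cong (trans (coeff-- p p n) (-‿inverseʳ _))) deg-0))
          (AddInfimum.⊥₋≤ [ B ])
    }

  0ᵀ : 𝕋
  0ᵀ = fromPoly []

  private
    open import Algebra.Properties.AbelianGroup +-abelianGroup using (⁻¹-∙-comm)
    open import Algebra.Properties.CommutativeSemigroup
      (CommutativeRing.+-commutativeSemigroup commutativeRing) using (interchange)

    +ᴾ--ᴾ : ∀ p p′ r r′ n →
      coeff ((p +ᴾ r) -ᴾ (p′ +ᴾ r′)) n ≈ coeff (p -ᴾ p′) n + coeff (r -ᴾ r′) n
    +ᴾ--ᴾ p p′ r r′ n =
      trans (coeff-- (p +ᴾ r) (p′ +ᴾ r′) n)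
      (trans (+-cong (coeff-+ p r n)
               (trans (-‿cong (coeff-+ p′ r′ n)) (sym (⁻¹-∙-comm _ _))))
      (trans (interchange _ _ _ _)
        (+-cong (sym (coeff-- p p′ n)) (sym (coeff-- r r′ n)))))

  infixl 6 _+ᵀ_

  _+ᵀ_ : 𝕋 → 𝕋 → 𝕋
  s +ᵀ t = record
    { seq    = λ n → seq s n +ᴾ seq t n
    ; cauchy = λ B → let (M , f) = cauchy s B ; (N , g) = cauchy t B in
        M ℕ.⊔ N , λ m n M⊔N≤m M⊔N≤n k →
          ≡.subst (_≤₋ [ B ])
            (≡.sym (deg-cong (+ᴾ--ᴾ (seq s m) (seq s n) (seq t m) (seq t n) k)))
            (ultrametric
              (f m n (ℕ.m⊔n≤o⇒m≤o M N M⊔N≤m) (ℕ.m⊔n≤o⇒m≤o M N M⊔N≤n) k)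
              (g m n (ℕ.m⊔n≤o⇒n≤o M N M⊔N≤m) (ℕ.m⊔n≤o⇒n≤o M N M⊔N≤n) k))
    }

  -- s is the sum of the family f: the net of its finite partial sums tends to s.
  HasSum : ∀ {i ℓᵢ} (I : Setoid i ℓᵢ) → (Setoid.Carrier I → 𝕋) → 𝕋 → Set (i ⊔ ℓᵢ)
  HasSum I f s = ∀ (B : ℚ) → Σ[ S ∈ List (Setoid.Carrier I) ]
    ∀ S′ → Unique S′ → S ⊆ S′ → dist[ s , foldr _+ᵀ_ 0ᵀ (map f S′) ]≤q^ B
    where
    open import Data.List.Relation.Unary.Unique.Setoid I using (Unique)
    open import Data.List.Relation.Binary.Subset.Setoid I using (_⊆_)

  ----------------------------------------------------------------------
  -- A = 𝔽_q[θ], and the maps A → ℂ∞ and χ_t : A → 𝔽_q[t] ⊂ 𝕋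

  module A = Polynomial 𝔽.commutativeRing

  ⟦_⟧ : A.Poly → Carrier
  ⟦ a ⟧ = eval (map ι a) θ

  -- Substituting t for θ leaves the list of coefficients unchanged.
  χₜ : A.Poly → Poly
  χₜ = map ι

  ----------------------------------------------------------------------
  -- Ω^r and 𝓔₁.  The index i : Fin r stands for the subscript toℕ i + 1.

  record Ω (r : ℕ) : Set (c ⊔ c′ ⊔ ℓ′) where
    field
      z           : Vector Carrier r
      z₁≈1        : ∀ i → toℕ i ≡ 0 → z i ≈ 1#
      independent : ∀ (k : Vector Carrier r) → (∀ i → k i ∈K∞) →
                    sum (λ i → k i * z i) ≈ 0# → ∀ i → k i ≈ 0#
  open Ω

  Aʳ : ℕ → Setoid c ℓ
  Aʳ r = record
    { Carrier       = Vector A.Poly r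
    ; _≈_           = λ a b → ∀ i → a i A.≈ᴾ b i
    ; isEquivalence = record
      { refl  = λ _ _ → 𝔽.refl
      ; sym   = λ e i n → 𝔽.sym (e i n)
      ; trans = λ e f i n → 𝔽.trans (e i n) (f i n)
      }
    }

  Aʳ∖0 : ℕ → Setoid (c ⊔ ℓ) ℓ
  Aʳ∖0 r = On.setoid (Aʳ r) (proj₁ {B = λ a → ¬ (∀ i → a i A.≈ᴾ [])})

  _∙_ : ∀ {r} → Ω r → Vector A.Poly r → Carrier
  ω ∙ a = sum (λ i → z ω i * ⟦ a i ⟧)

  -- The i-th entry of (𝒛𝒂)⁻¹ ρ_t(𝒂)
  term : ∀ {r} → Ω r → Fin r → Setoid.Carrier (Aʳ∖0 r) → 𝕋
  term ω i (a , _) = fromPoly (scale ((ω ∙ a) ⁻¹) (χₜ (a i)))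

  -- E = 𝓔₁(𝒛): every entry E i is the sum of the series ε_i(𝒛).
  _Is𝓔₁At_ : ∀ {r} → Vector 𝕋 r → Ω r → Set (c ⊔ ℓ)
  _Is𝓔₁At_ {r} E ω = ∀ i → HasSum (Aʳ∖0 r) (term ω i) (E i)

{-# OPTIONS --safe #-}
-- The coefficient of t⁰ of εᵢ(𝒛) is a sum of c/(𝒛𝒂) over 𝒂 ≠ 0, where c is
-- the constant coefficient of aᵢ.  Let W be a finite 𝔽_q-space of lattice
-- points with c = 0, and e the point 𝒛𝒂 for 𝒂 the i-th unit vector.  Grouping
-- by c, and using Σ_{c ∈ 𝔽_q^×} 1 = -1, the part of the sum over 𝔽_q e + W is
-- -Σ_{w ∈ W} 1/(e + w).  The differences of elements of W again run through
-- W, so the partial fraction expansion of ∏ 1/(x + w) gives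
--   Σ_{w ∈ W} 1/(e + w) = ∏_{w ∈ W∖0} w / ∏_{w ∈ W} (e + w).
-- A factor w/(e + w) has absolute value 1 as soon as |w| > |e|, and convergence
-- of the Eisenstein series leaves only finitely many w without this property.
-- Hence the absolute values of these sums are bounded below as W grows.
module Submission where

open import Defs
open import Algebra.Bundles using (CommutativeMonoid; CommutativeRing)
open import Algebra.Morphism.Structures using (IsRingHomomorphism)
open import Data.Fin.Base using (Fin; zero; suc; toℕ; fromℕ<)
import Data.Fin.Properties as Fin
open import Data.List.Base
  using ( List; []; _∷_; _++_; _∷ʳ_; allFin; cartesianProduct; cartesianProductWith
        ; filter; foldr; length; map; reverse)
import Data.List.Extrema as Extrema
open import Data.List.Membership.Propositional using (_∈_)
open import Data.List.Membership.Propositional.Properties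
  using ( ∈-allFin; ∈-cartesianProduct⁺; ∈-cartesianProduct⁻; ∈-cartesianProductWith⁺
        ; ∈-filter⁺; ∈-filter⁻; ∈-map⁺; ∈-map⁻)
open import Data.List.Membership.Propositional.Properties.WithK using (unique∧set⇒bag)
import Data.List.Properties as List
open import Data.List.Relation.Binary.BagAndSetEquality using (∼bag⇒↭)
open import Data.List.Relation.Binary.Permutation.Propositional as Perm using (_↭_; prep; swap)
open import Data.List.Relation.Unary.All as All using (All; []; _∷_)
import Data.List.Relation.Unary.All.Properties as All
open import Data.List.Relation.Unary.AllPairs as AllPairs using (AllPairs; []; _∷_)
open import Data.List.Relation.Unary.Any as Any using (Any; here; there; any?; _─_)
import Data.List.Relation.Unary.Any.Properties as Any
open import Data.List.Relation.Unary.Unique.Propositional using (Unique)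
import Data.List.Relation.Unary.Unique.Propositional.Properties as Unique
import Data.List.Relation.Unary.Unique.Setoid as SetoidUnique
open import Data.Nat.Base as ℕ using (ℕ; zero; suc; _≤_)
import Data.Nat.Properties as ℕ
open import Data.Product.Base using (∃-syntax; _×_; _,_; proj₁; proj₂)
open import Data.Rational.Base as ℚ using (ℚ; 0ℚ; 1ℚ)
import Data.Rational.Properties as ℚ
open import Data.Sum.Base as Sum using (_⊎_; inj₁; inj₂)
open import Data.Vec.Base as Vec using (Vec; []; _∷_; lookup; tabulate)
open import Data.Vec.Functional using (Vector)
import Data.Vec.Properties as Vec
open import Data.Vec.Relation.Binary.Pointwise.Extensional using (ext; extensional⇒inductive)
open import Data.Vec.Relation.Binary.Pointwise.Inductive using (Pointwise-≡⇒≡)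
open import Function.Bundles using (Inverse; mk⇔)
open import Level using (Level)
open import Relation.Binary.Bundles using (DecTotalOrder; Setoid)
import Relation.Binary.Construct.Add.Infimum.NonStrict ℚ._≤_ as ℚ₋
open import Relation.Binary.Definitions using (Decidable)
open import Relation.Binary.PropositionalEquality as ≡ using (_≡_)
open import Relation.Nullary.Construct.Add.Infimum using (⊥₋; [_])
open import Relation.Nullary.Decidable.Core using (yes; no)
open import Relation.Nullary.Negation using (¬_; contradiction)

open import Algebra.Properties.AbelianGroup ℚ.+-0-abelianGroup using ()
  renaming ( inverseˡ-unique to ℚ-inverseˡ-unique; identityʳ-unique to ℚ-identityʳ-unique
           ; ε⁻¹≈ε to ℚ-0≡0; ⁻¹-involutive to ℚ-neg-involutive; xyx⁻¹≈y to ℚ-xyx⁻¹≈y)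
open import Algebra.Properties.CommutativeSemigroup
  (CommutativeMonoid.commutativeSemigroup ℚ.+-0-commutativeMonoid) using ()
  renaming (interchange to ℚ-interchange; x∙yz≈y∙xz to ℚ-x∙yz≈y∙xz)

-- A lower bound for the finite sums is of use only if it survives the limit, so the order of
-- choices matters: the bound D is fixed first, and only then is an index set chosen on which the
-- partial sum approximates εᵢ up to q^(D-1). The factors that can lower the degree belong to a list
-- of values fixed in advance, and each value is met at most once because linear independence over
-- K∞ makes the lattice points distinct. The index sets are boxes, given by a bound on the lengths
-- of the polynomials. They are 𝔽_q-spaces, so every identity holds exactly at a finite stage and no
-- infinite product is formed. The constant coefficient of aᵢ enters only as an 𝔽_q-linear form with
-- value 1 at e. Discreteness of the lattice is also read off from the series: an index outside a
-- large box has small terms in all coordinates, and in one of them the term has norm 1/|𝒛𝒂|.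

private variable
  ℓ₁ ℓ₂ : Level
  A : Set ℓ₁
  B : Set ℓ₂

-- Finite sums and products over lists

map-unique : ∀ (f : A → B) {xs} → (∀ {x y} → x ∈ xs → y ∈ xs → f x ≡ f y → x ≡ y) →
             Unique xs → Unique (map f xs)
map-unique f inj []         = []
map-unique f inj (x∉ ∷ uxs) =
  All.map⁺ (All.tabulate λ y∈ e → All.lookup x∉ y∈ (inj (here ≡.refl) (there y∈) e)) ∷
  map-unique f (λ p r → inj (there p) (there r)) uxs

module BigOperator {c ℓ} (M : CommutativeMonoid c ℓ) where
  open CommutativeMonoid M
  open import Algebra.Properties.CommutativeSemigroup commutativeSemigroup
    using (interchange; x∙yz≈y∙xz)

  ⨁ : (A → Carrier) → List A → Carrier
  ⨁ f xs = foldr _∙_ ε (map f xs)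

  ⨁-cong : ∀ {f g : A → Carrier} xs → (∀ {x} → x ∈ xs → f x ≈ g x) → ⨁ f xs ≈ ⨁ g xs
  ⨁-cong []       e = refl
  ⨁-cong (x ∷ xs) e = ∙-cong (e (here ≡.refl)) (⨁-cong xs (λ p → e (there p)))

  ⨁-ε : ∀ (xs : List A) → ⨁ (λ _ → ε) xs ≈ ε
  ⨁-ε []       = refl
  ⨁-ε (x ∷ xs) = trans (identityˡ _) (⨁-ε xs)

  ⨁-∙ : ∀ (f g : A → Carrier) xs → ⨁ (λ x → f x ∙ g x) xs ≈ ⨁ f xs ∙ ⨁ g xs
  ⨁-∙ f g []       = sym (identityˡ ε)
  ⨁-∙ f g (x ∷ xs) = trans (∙-congˡ (⨁-∙ f g xs)) (interchange _ _ _ _)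

  ⨁-map : ∀ (f : B → Carrier) (h : A → B) xs → ⨁ f (map h xs) ≈ ⨁ (λ x → f (h x)) xs
  ⨁-map f h []       = refl
  ⨁-map f h (x ∷ xs) = ∙-congˡ (⨁-map f h xs)

  ⨁-↭ : ∀ (f : A → Carrier) {xs ys} → xs ↭ ys → ⨁ f xs ≈ ⨁ f ys
  ⨁-↭ f Perm.refl         = refl
  ⨁-↭ f (prep x p)        = ∙-congˡ (⨁-↭ f p)
  ⨁-↭ f (swap x y p)      =
    trans (x∙yz≈y∙xz _ _ _) (∙-congˡ (∙-congˡ (⨁-↭ f p)))
  ⨁-↭ f (Perm.trans p q)  = trans (⨁-↭ f p) (⨁-↭ f q)

  -- Two duplicate-free lists with the same members are permutations of each other, so bijectivity
  -- on members is enough for a change of variable.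
  ⨁-reindex : ∀ (f : B → Carrier) (σ : A → B) {xs ys} → Unique xs → Unique ys →
              (∀ {x y} → x ∈ xs → y ∈ xs → σ x ≡ σ y → x ≡ y) →
              (∀ {x} → x ∈ xs → σ x ∈ ys) →
              (∀ {y} → y ∈ ys → ∃[ x ] x ∈ xs × y ≡ σ x) →
              ⨁ (λ x → f (σ x)) xs ≈ ⨁ f ys
  ⨁-reindex f σ {xs} {ys} uxs uys σ-inj into onto =
    trans (sym (⨁-map f σ xs)) (⨁-↭ f (∼bag⇒↭ (unique∧set⇒bag (map-unique σ σ-inj uxs) uys
      (mk⇔ (λ p → let (_ , x∈ , e) = ∈-map⁻ σ p in ≡.subst (_∈ ys) (≡.sym e) (into x∈))
           (λ p → let (_ , x∈ , e) = onto p in ≡.subst (_∈ map σ xs) (≡.sym e) (∈-map⁺ σ x∈))))))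

  ⨁-++ : ∀ (f : A → Carrier) xs ys → ⨁ f (xs ++ ys) ≈ ⨁ f xs ∙ ⨁ f ys
  ⨁-++ f []       ys = sym (identityˡ _)
  ⨁-++ f (x ∷ xs) ys = trans (∙-congˡ (⨁-++ f xs ys)) (sym (assoc _ _ _))

  ⨁-× : ∀ (f : A → B → Carrier) xs ys →
        ⨁ (λ p → f (proj₁ p) (proj₂ p)) (cartesianProduct xs ys) ≈
        ⨁ (λ x → ⨁ (f x) ys) xs
  ⨁-× f []       ys = refl
  ⨁-× f (x ∷ xs) ys = trans (⨁-++ _ (map (x ,_) ys) _)
    (∙-cong (⨁-map _ (x ,_) ys) (⨁-× f xs ys))

open BigOperator ℚ.+-0-commutativeMonoid using ()
  renaming (⨁ to Σℚ; ⨁-cong to Σℚ-cong)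

-- Partial fractions over a field with decidable equality

module PartialFractions {c ℓ} (F : Field c ℓ) (_≟_ : Decidable (Field._≈_ F)) where
  open Field F
  open import Algebra.Properties.Ring ring
  open import Relation.Binary.Reasoning.Setoid setoid
  open import Algebra.Properties.CommutativeSemigroup *-commutativeSemigroup
    using (x∙yz≈y∙xz; interchange)
  open BigOperator +-commutativeMonoid public
    renaming (⨁ to Σ; ⨁-cong to Σ-cong; ⨁-ε to Σ-0; ⨁-∙ to Σ-+; ⨁-reindex to Σ-reindex; ⨁-× to Σ-×)
    using ()
  open BigOperator *-commutativeMonoid public
    renaming (⨁ to Π; ⨁-cong to Π-cong; ⨁-reindex to Π-reindex)
    using ()

  Σ-*ˡ : ∀ x (f : A → Carrier) xs → Σ (λ a → x * f a) xs ≈ x * Σ f xs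
  Σ-*ˡ x f []       = sym (zeroʳ x)
  Σ-*ˡ x f (a ∷ xs) = trans (+-congˡ (Σ-*ˡ x f xs)) (sym (distribˡ _ _ _))

  Σ-neg : ∀ (f : A → Carrier) xs → Σ (λ a → - f a) xs ≈ - Σ f xs
  Σ-neg f []       = sym -0#≈0#
  Σ-neg f (a ∷ xs) = trans (+-congˡ (Σ-neg f xs)) (-‿+-comm _ _)

  cancelˡ : ∀ {x y z} → x ≉ 0# → x * y ≈ x * z → y ≈ z
  cancelˡ {x} {y} {z} x≉0 e = trans (sym (lem y)) (trans (*-congˡ e) (lem z))
    where
    lem : ∀ y → x ⁻¹ * (x * y) ≈ y
    lem y = trans (sym (*-assoc _ _ _)) (trans (*-congʳ (trans (*-comm _ _) (inverseʳ x x≉0))) (*-identityˡ y))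

  x*y≉0 : ∀ {x y} → x ≉ 0# → y ≉ 0# → x * y ≉ 0#
  x*y≉0 x≉0 y≉0 e = y≉0 (cancelˡ x≉0 (trans e (sym (zeroʳ _))))

  -- Sending 0 to 1 makes the factor at b = a in ∏_b inv (y b - y a) harmless.
  inv : Carrier → Carrier
  inv x with x ≟ 0#
  ... | yes _ = 1#
  ... | no  _ = x ⁻¹

  inv-0 : ∀ {x} → x ≈ 0# → inv x ≈ 1#
  inv-0 {x} x≈0 with x ≟ 0#
  ... | yes _   = refl
  ... | no  x≉0 = contradiction x≈0 x≉0

  inv-⁻¹ : ∀ {x} → x ≉ 0# → inv x ≡ x ⁻¹
  inv-⁻¹ {x} x≉0 with x ≟ 0#
  ... | yes x≈0 = contradiction x≈0 x≉0
  ... | no  _   = ≡.refl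

  inv-inverseʳ : ∀ {x} → x ≉ 0# → x * inv x ≈ 1#
  inv-inverseʳ {x} x≉0 = trans (*-congˡ (reflexive (inv-⁻¹ x≉0))) (inverseʳ x x≉0)

  inv-unique : ∀ {x y} → x * y ≈ 1# → x ≉ 0# → y ≈ inv x
  inv-unique e x≉0 = cancelˡ x≉0 (trans e (sym (inv-inverseʳ x≉0)))

  inv-cong : ∀ {x y} → x ≈ y → inv x ≈ inv y
  inv-cong {x} {y} e with y ≟ 0#
  ... | yes y≈0 = inv-0 (trans e y≈0)
  ... | no  y≉0 = sym (cancelˡ x≉0 (trans (trans (*-congʳ e) (inverseʳ y y≉0)) (sym (inv-inverseʳ x≉0))))
    where x≉0 = λ x≈0 → y≉0 (trans (sym e) x≈0)

  inv≉0 : ∀ x → inv x ≉ 0#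
  inv≉0 x e with x ≟ 0#
  ... | yes _   = 1≉0 e
  ... | no  x≉0 = 1≉0 (trans (sym (inverseʳ x x≉0)) (trans (*-congˡ e) (zeroʳ x)))

  neg≉0 : ∀ {x} → x ≉ 0# → - x ≉ 0#
  neg≉0 x≉0 e = x≉0 (trans (sym (-‿involutive _)) (trans (-‿cong e) -0#≈0#))

  inv-neg : ∀ {x} → x ≉ 0# → inv (- x) ≈ - inv x
  inv-neg {x} x≉0 = sym (inv-unique
    (begin
      - x * - inv x    ≈⟨ -‿distribˡ-* x (- inv x) ⟨
      - (x * - inv x)  ≈⟨ -‿cong (-‿distribʳ-* x (inv x)) ⟨
      - - (x * inv x)  ≈⟨ -‿involutive _ ⟩
      x * inv x        ≈⟨ inv-inverseʳ x≉0 ⟩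
      1#               ∎)
    (neg≉0 x≉0))

  inv-* : ∀ {x y} → x ≉ 0# → y ≉ 0# → inv (x * y) ≈ inv x * inv y
  inv-* {x} {y} x≉0 y≉0 = sym (inv-unique
    (trans (interchange _ _ _ _)
      (trans (*-cong (inv-inverseʳ x≉0) (inv-inverseʳ y≉0)) (*-identityˡ 1#)))
    (x*y≉0 x≉0 y≉0))

  -- This is u/(v d) = 1/d + 1/v divided by u. In the induction below, u = x + y a, v = x + y b and
  -- d = y a - y b.
  inv*inv : ∀ {u v d} → u ≈ v + d → u ≉ 0# → v ≉ 0# → d ≉ 0# →
            inv v * inv d ≈ inv u * inv v + inv u * inv d
  inv*inv {u} {v} {d} u≈v+d u≉0 v≉0 d≉0 = cancelˡ u≉0 (begin
    u * (inv v * inv d)                          ≈⟨ *-congʳ u≈v+d ⟩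
    (v + d) * (inv v * inv d)                    ≈⟨ distribʳ _ _ _ ⟩
    v * (inv v * inv d) + d * (inv v * inv d)    ≈⟨ +-cong (absorb v≉0) (trans (x∙yz≈y∙xz _ _ _)
                                                      (trans (*-congˡ (inv-inverseʳ d≉0)) (*-identityʳ _))) ⟩
    inv d + inv v                                ≈⟨ +-comm _ _ ⟩
    inv v + inv d                                ≈⟨ +-cong (absorb u≉0) (absorb u≉0) ⟨
    u * (inv u * inv v) + u * (inv u * inv d)    ≈⟨ distribˡ _ _ _ ⟨
    u * (inv u * inv v + inv u * inv d)          ∎)
    where
    absorb : ∀ {x y} → x ≉ 0# → x * (inv x * y) ≈ y
    absorb x≉0 = trans (sym (*-assoc _ _ _)) (trans (*-congʳ (inv-inverseʳ x≉0)) (*-identityˡ _))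

  module _ (y : A → Carrier) where

    -- Induction on the list. After `split`, the first halves form the instance for the tail at x.
    -- The second halves form the instance for the tail at - y a, whose value `Q a` cancels the
    -- summand of the head. The list has a head because the empty sum is 0 while the empty product
    -- is 1.
    partialFractions : ∀ x a as → AllPairs (λ a b → y a ≉ y b) (a ∷ as) →
      All (λ b → x + y b ≉ 0#) (a ∷ as) →
      Σ (λ b → inv (x + y b) * Π (λ c → inv (y c - y b)) (a ∷ as)) (a ∷ as) ≈
      Π (λ b → inv (x + y b)) (a ∷ as)
    partialFractions x a [] _ _ = trans (+-identityʳ _)
      (*-congˡ (trans (*-congʳ (inv-0 (-‿inverseʳ (y a)))) (*-identityˡ 1#)))
    partialFractions x a as@(a′ ∷ as′) (a≉as ∷ as-distinct) (u≉0 ∷ v≉0) = begin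
      inv u * (inv (y a - y a) * Q a) + Σ (λ b → inv (x + y b) * (inv (y a - y b) * Q b)) as
        ≈⟨ +-cong (*-congˡ (trans (*-congʳ (inv-0 (-‿inverseʳ (y a)))) (*-identityˡ _)))
                  (Σ-cong as split) ⟩
      inv u * Q a + Σ (λ b → inv u * (inv (x + y b) * Q b) + inv u * - (inv (- y a + y b) * Q b)) as
        ≈⟨ +-congˡ (Σ-+ (λ b → inv u * (inv (x + y b) * Q b)) _ as) ⟩
      inv u * Q a + (Σ (λ b → inv u * (inv (x + y b) * Q b)) as
                      + Σ (λ b → inv u * - (inv (- y a + y b) * Q b)) as)
        ≈⟨ +-congˡ (+-cong
             (trans (Σ-*ˡ (inv u) _ as) (*-congˡ (partialFractions x a′ as′ as-distinct v≉0)))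
             (trans (Σ-*ˡ (inv u) _ as) (*-congˡ (trans (Σ-neg _ as) (-‿cong
               (trans (partialFractions (- y a) a′ as′ as-distinct (All.map -ya+yb≉0 a≉as))
                      (Π-cong as (λ _ → inv-cong (+-comm _ _))))))))) ⟩
      inv u * Q a + (inv u * P + inv u * - Q a)
        ≈⟨ +-congˡ (trans (+-congˡ (sym (-‿distribʳ-* _ _))) (+-comm _ _)) ⟩
      inv u * Q a + (- (inv u * Q a) + inv u * P)
        ≈⟨ trans (sym (+-assoc _ _ _)) (trans (+-congʳ (-‿inverseʳ _)) (+-identityˡ _)) ⟩
      inv u * P ∎
      where
      u = x + y a
      P = Π (λ b → inv (x + y b)) as
      Q = λ b → Π (λ c → inv (y c - y b)) as

      -ya+yb≉0 : ∀ {b} → y a ≉ y b → - y a + y b ≉ 0#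
      -ya+yb≉0 ya≉yb e = ya≉yb (sym (x∙y⁻¹≈ε⇒x≈y _ _ (trans (+-comm _ _) e)))

      u≈v+d : ∀ b → u ≈ (x + y b) + (y a - y b)
      u≈v+d b = begin
        x + y a                    ≈⟨ +-congˡ (trans (+-congˡ (-‿inverseˡ _)) (+-identityʳ _)) ⟨
        x + (y a + (- y b + y b))  ≈⟨ +-congˡ (trans (sym (+-assoc _ _ _)) (+-comm _ _)) ⟩
        x + (y b + (y a - y b))    ≈⟨ +-assoc _ _ _ ⟨
        (x + y b) + (y a - y b)    ∎

      split : ∀ {b} → b ∈ as →
        inv (x + y b) * (inv (y a - y b) * Q b) ≈
        inv u * (inv (x + y b) * Q b) + inv u * - (inv (- y a + y b) * Q b)
      split {b} b∈as = begin
        inv (x + y b) * (inv (y a - y b) * Q b)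
          ≈⟨ *-assoc _ _ _ ⟨
        inv (x + y b) * inv (y a - y b) * Q b
          ≈⟨ *-congʳ (inv*inv (u≈v+d b) u≉0 (All.lookup v≉0 b∈as)
               (λ e → All.lookup a≉as b∈as (x∙y⁻¹≈ε⇒x≈y _ _ e))) ⟩
        (inv u * inv (x + y b) + inv u * inv (y a - y b)) * Q b
          ≈⟨ trans (distribʳ _ _ _) (+-cong (*-assoc _ _ _) (*-assoc _ _ _)) ⟩
        inv u * (inv (x + y b) * Q b) + inv u * (inv (y a - y b) * Q b)
          ≈⟨ +-congˡ (*-congˡ (trans (*-congʳ (trans (inv-cong flip)
               (inv-neg (-ya+yb≉0 (All.lookup a≉as b∈as))))) (sym (-‿distribˡ-* _ _)))) ⟩
        inv u * (inv (x + y b) * Q b) + inv u * - (inv (- y a + y b) * Q b) ∎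
        where
        flip : y a - y b ≈ - (- y a + y b)
        flip = trans (+-congʳ (sym (-‿involutive _))) (-‿+-comm _ _)

    -- If ∏_c inv (y c - y b) does not depend on b, then all the partial
    -- fractions of ∏ 1 / (x + y b) have the same numerator.
    Σ-inv : ∀ {h} x a as → AllPairs (λ a b → y a ≉ y b) (a ∷ as) →
      All (λ b → x + y b ≉ 0#) (a ∷ as) →
      (∀ {b} → b ∈ a ∷ as → Π (λ c → inv (y c - y b)) (a ∷ as) ≈ h) →
      h * Σ (λ b → inv (x + y b)) (a ∷ as) ≈ Π (λ b → inv (x + y b)) (a ∷ as)
    Σ-inv {h} x a as distinct ≉0 const = begin
      h * Σ (λ b → inv (x + y b)) (a ∷ as)    ≈⟨ Σ-*ˡ h _ (a ∷ as) ⟨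
      Σ (λ b → h * inv (x + y b)) (a ∷ as)    ≈⟨ Σ-cong (a ∷ as) (λ p → trans (*-comm _ _) (*-congˡ (sym (const p)))) ⟩
      Σ (λ b → inv (x + y b) * Π (λ c → inv (y c - y b)) (a ∷ as)) (a ∷ as)
                                              ≈⟨ partialFractions x a as distinct ≉0 ⟩
      Π (λ b → inv (x + y b)) (a ∷ as)        ∎

-- Degrees in a valued field

module Valuation {c ℓ} (V : ValuedField c ℓ) where
  open ValuedField V
  open import Algebra.Properties.Ring ring

  [≤] : ∀ {p q} → [ p ] ≤₋ [ q ] → p ℚ.≤ q
  [≤] = ℚ₋.[≤]-injective

  ≤₋-trans : ∀ {x y z} → x ≤₋ y → y ≤₋ z → x ≤₋ z
  ≤₋-trans = ℚ₋.≤₋-trans ℚ.≤-trans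

  infix 4 _≟_
  -- The degree is ⊥₋ exactly at 0, and whether a value is ⊥₋ can be read off; this makes equality
  -- decidable constructively.
  _≟_ : Decidable _≈_
  x ≟ y with deg (x - y) in e
  ... | ⊥₋    = yes (x∙y⁻¹≈ε⇒x≈y x y (deg-⊥₋ e))
  ... | [ _ ] = no λ x≈y → contradiction
    (≡.trans (≡.sym e) (≡.trans (deg-cong (x≈y⇒x∙y⁻¹≈ε x≈y)) deg-0)) λ ()

  open PartialFractions fld _≟_

  -- With the junk value δ 0 = 0, matching inv 0 = 1, one has
  -- δ (inv x) ≡ - δ x for all x.
  δ : Carrier → ℚ
  δ x with deg x
  ... | ⊥₋    = 0ℚ
  ... | [ d ] = d

  δ-cong : ∀ {x y} → x ≈ y → δ x ≡ δ y
  δ-cong e rewrite deg-cong e = ≡.refl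

  deg-δ : ∀ {x} → x ≉ 0# → deg x ≡ [ δ x ]
  deg-δ {x} x≉0 with deg x in e
  ... | ⊥₋    = contradiction (deg-⊥₋ e) x≉0
  ... | [ _ ] = ≡.refl

  δ-deg : ∀ {x d} → deg x ≡ [ d ] → δ x ≡ d
  δ-deg e rewrite e = ≡.refl

  δ-0 : ∀ {x} → x ≈ 0# → δ x ≡ 0ℚ
  δ-0 x≈0 rewrite deg-cong x≈0 | deg-0 = ≡.refl

  δ-≤ : ∀ {x b} → x ≉ 0# → deg x ≤₋ [ b ] → δ x ℚ.≤ b
  δ-≤ x≉0 p = [≤] (≡.subst (_≤₋ _) (deg-δ x≉0) p)

  δ-* : ∀ {x y} → x ≉ 0# → y ≉ 0# → δ (x * y) ≡ δ x ℚ.+ δ y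
  δ-* {x} {y} x≉0 y≉0 = δ-deg (≡.trans (deg-* x y) (≡.cong₂ _+₋_ (deg-δ x≉0) (deg-δ y≉0)))

  δ-1 : δ 1# ≡ 0ℚ
  δ-1 = ℚ-identityʳ-unique (δ 1#) (δ 1#)
    (≡.sym (≡.trans (δ-cong (sym (*-identityˡ 1#))) (δ-* 1≉0 1≉0)))

  δ-inv : ∀ x → δ (inv x) ≡ ℚ.- δ x
  δ-inv x with x ≟ 0#
  ... | yes x≈0 = ≡.trans δ-1 (≡.sym (≡.trans (≡.cong ℚ.-_ (δ-0 x≈0)) ℚ-0≡0))
  ... | no  x≉0 = ℚ-inverseˡ-unique _ _
    (≡.trans (≡.sym (δ-* ⁻¹≉0 x≉0)) (≡.trans (δ-cong (trans (*-comm _ _) (inverseʳ x x≉0))) δ-1))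
    where
    ⁻¹≉0 : x ⁻¹ ≉ 0#
    ⁻¹≉0 e = inv≉0 x (trans (reflexive (inv-⁻¹ x≉0)) e)

  2q≡0⇒q≡0 : ∀ q → q ℚ.+ q ≡ 0ℚ → q ≡ 0ℚ
  2q≡0⇒q≡0 q e with ℚ.≤-total 0ℚ q
  ... | inj₁ 0≤q = ℚ.≤-antisym (≡.subst₂ ℚ._≤_ (ℚ.+-identityʳ q) e (ℚ.+-monoʳ-≤ q 0≤q)) 0≤q
  ... | inj₂ q≤0 = ℚ.≤-antisym q≤0 (≡.subst₂ ℚ._≤_ e (ℚ.+-identityʳ q) (ℚ.+-monoʳ-≤ q q≤0))

  -- The square of -1 is 1, and ℚ has no 2-torsion.
  δ-neg1 : δ (- 1#) ≡ 0ℚ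
  δ-neg1 = 2q≡0⇒q≡0 _ (≡.trans (≡.sym (δ-* -1≉0 -1≉0)) (≡.trans
    (δ-cong (trans (-1*x≈-x _) (-‿involutive 1#))) δ-1))
    where -1≉0 = neg≉0 1≉0

  deg-neg : ∀ x → deg (- x) ≡ deg x
  deg-neg x = ≡.trans (deg-cong (sym (-1*x≈-x x)))
    (≡.trans (deg-* (- 1#) x) (≡.trans
      (≡.cong (_+₋ deg x) (≡.trans (deg-δ (neg≉0 1≉0)) (≡.cong [_] δ-neg1)))
      (lem (deg x))))
    where
    lem : ∀ d → [ 0ℚ ] +₋ d ≡ d
    lem ⊥₋    = ≡.refl
    lem [ d ] = ≡.cong [_] (ℚ.+-identityˡ d)

  deg-- : ∀ {x y b} → deg x ≤₋ b → deg y ≤₋ b → deg (x - y) ≤₋ b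
  deg-- {y = y} p q = ultrametric p (≡.subst (_≤₋ _) (≡.sym (deg-neg y)) q)

  -- If x + y had degree below d, then so would y = (x + y) - x. The ultrametric inequality needs a
  -- common bound for both terms, hence the maximum of b and p below.
  deg-+-strict : ∀ {x y b d} → deg x ≤₋ [ b ] → deg y ≡ [ d ] → b ℚ.< d → deg (x + y) ≡ [ d ]
  deg-+-strict {x} {y} {b} {d} x≤b y≡d b<d = lem (deg (x + y)) ≡.refl
    where
    x+y-x≈y : (x + y) - x ≈ y
    x+y-x≈y = trans (+-congʳ (+-comm x y))
      (trans (+-assoc _ _ _) (trans (+-congˡ (-‿inverseʳ x)) (+-identityʳ y)))

    x+y≰ : ∀ {e} → b ℚ.≤ e → e ℚ.< d → ¬ deg (x + y) ≤₋ [ e ]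
    x+y≰ b≤e e<d p = ℚ.<-irrefl ≡.refl (ℚ.<-≤-trans e<d ([≤] (≡.subst (_≤₋ _)
      (≡.trans (deg-cong x+y-x≈y) y≡d) (deg-- p (≤₋-trans x≤b ℚ₋.[ b≤e ])))))

    x+y≤d : deg (x + y) ≤₋ [ d ]
    x+y≤d = ultrametric (≤₋-trans x≤b ℚ₋.[ ℚ.<⇒≤ b<d ])
      (ℚ₋.≤₋-reflexive-≡ ℚ.≤-reflexive y≡d)

    lem : ∀ e → deg (x + y) ≡ e → e ≡ [ d ]
    lem ⊥₋    e = contradiction (≡.subst (_≤₋ _) (≡.sym e) (ℚ₋.⊥₋≤ _)) (x+y≰ ℚ.≤-refl b<d)
    lem [ p ] e with p ℚ.<? d
    ... | no  p≮d = ≡.cong [_] (ℚ.≤-antisym ([≤] (≡.subst (_≤₋ _) e x+y≤d)) (ℚ.≮⇒≥ p≮d))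
    ... | yes p<d = contradiction
      (≡.subst (_≤₋ _) (≡.sym e) ℚ₋.[ ℚ.p≤q⊔p b p ])
      (x+y≰ (ℚ.p≤p⊔q b p) b⊔p<d)
      where
      b⊔p<d : b ℚ.⊔ p ℚ.< d
      b⊔p<d with ℚ.⊔-sel b p
      ... | inj₁ e = ≡.subst (ℚ._< d) (≡.sym e) b<d
      ... | inj₂ e = ≡.subst (ℚ._< d) (≡.sym e) p<d

  Π≉0 : ∀ {f : A → Carrier} → (∀ a → f a ≉ 0#) → ∀ as → Π f as ≉ 0#
  Π≉0 f≉0 []       = 1≉0
  Π≉0 f≉0 (a ∷ as) = x*y≉0 (f≉0 a) (Π≉0 f≉0 as)

  δ-Π : ∀ {f : A → Carrier} → (∀ a → f a ≉ 0#) → ∀ as → δ (Π f as) ≡ Σℚ (λ a → δ (f a)) as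
  δ-Π f≉0 []       = δ-1
  δ-Π {f = f} f≉0 (a ∷ as) =
    ≡.trans (δ-* (f≉0 a) (Π≉0 f≉0 as)) (≡.cong (δ (f a) ℚ.+_) (δ-Π f≉0 as))

  -- For nonzero y and x + y this is log_q |y/(x + y)|, the share of y in the degree of the product.
  -- At y = 0 it is - δ x, which matches the product ∏ w over nonzero w only.
  drop : Carrier → Carrier → ℚ
  drop x y = δ y ℚ.- δ (x + y)

  drop-cong : ∀ {x y z} → y ≈ z → drop x y ≡ drop x z
  drop-cong e = ≡.cong₂ ℚ._-_ (δ-cong e) (δ-cong (+-congˡ e))

  drop-large : ∀ {x y} → y ≉ 0# → ¬ deg y ≤₋ [ δ x ] → drop x y ≡ 0ℚ
  drop-large {x} {y} y≉0 y≰x with x ≟ 0#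
  -- Here δ x is only a default value and bounds nothing, but x + y ≈ y.
  ... | yes x≈0 = ≡.trans
    (≡.cong (λ d → δ y ℚ.- d) (δ-cong (trans (+-congʳ x≈0) (+-identityˡ y))))
    (ℚ.+-inverseʳ (δ y))
  ... | no  x≉0 = ≡.trans (≡.cong (λ d → δ y ℚ.- d) (δ-deg (deg-+-strict {x} {y} {δ x}
    (ℚ₋.≤₋-reflexive-≡ ℚ.≤-reflexive (deg-δ x≉0)) (deg-δ y≉0)
    (ℚ.≰⇒> (λ p → y≰x (≡.subst (_≤₋ [ δ x ]) (≡.sym (deg-δ y≉0)) ℚ₋.[ p ]))))))
    (ℚ.+-inverseʳ (δ y))

  module _ (y : A → Carrier) where

    -- The last hypothesis says that the common numerator is H, so that H * s ≈ P. Both H and P are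
    -- products of values of `inv`, which never vanishes; thus s is nonzero, and its degree is the
    -- difference of two sums taken factor by factor.
    δ-Σ-inv : ∀ x a as → AllPairs (λ a b → y a ≉ y b) (a ∷ as) →
      All (λ b → x + y b ≉ 0#) (a ∷ as) →
      (∀ {b} → b ∈ a ∷ as → Π (λ c → inv (y c - y b)) (a ∷ as) ≈ Π (λ c → inv (y c)) (a ∷ as)) →
      let s = Σ (λ b → inv (x + y b)) (a ∷ as) in
      s ≉ 0# × δ s ≡ Σℚ (λ b → drop x (y b)) (a ∷ as)
    δ-Σ-inv x a as distinct ≉0 const = s≉0 , (begin
      δ s
        ≡⟨ ℚ-move (≡.trans (≡.sym (δ-* H≉0 s≉0)) (δ-cong H*s≈P)) ⟩
      δ P ℚ.- δ H
        ≡⟨ ≡.cong₂ ℚ._-_ (δ-Π (λ b → inv≉0 _) (a ∷ as)) (δ-Π (λ b → inv≉0 _) (a ∷ as)) ⟩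
      Σℚ (λ b → δ (inv (x + y b))) (a ∷ as) ℚ.- Σℚ (λ b → δ (inv (y b))) (a ∷ as)
        ≡⟨ lem (a ∷ as) ⟩
      Σℚ (λ b → drop x (y b)) (a ∷ as) ∎)
      where
      open ≡.≡-Reasoning
      s = Σ (λ b → inv (x + y b)) (a ∷ as)
      P = Π (λ b → inv (x + y b)) (a ∷ as)
      H = Π (λ b → inv (y b)) (a ∷ as)
      H≉0 = Π≉0 (λ b → inv≉0 (y b)) (a ∷ as)
      H*s≈P : H * s ≈ P
      H*s≈P = Σ-inv y x a as distinct ≉0 const
      s≉0 : s ≉ 0#
      s≉0 e = Π≉0 (λ b → inv≉0 (x + y b)) (a ∷ as) (trans (sym H*s≈P) (trans (*-congˡ e) (zeroʳ H)))
      ℚ-move : ∀ {p q r} → p ℚ.+ q ≡ r → q ≡ r ℚ.- p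
      ℚ-move {p} {q} e = ≡.trans (≡.sym (ℚ-xyx⁻¹≈y p q)) (≡.cong (ℚ._- p) e)
      step : ∀ b → δ (inv (x + y b)) ℚ.- δ (inv (y b)) ≡ drop x (y b)
      step b = ≡.trans (≡.cong₂ ℚ._-_ (δ-inv (x + y b)) (δ-inv (y b)))
        (≡.trans (≡.cong (ℚ.- δ (x + y b) ℚ.+_) (ℚ-neg-involutive (δ (y b))))
                 (ℚ.+-comm (ℚ.- δ (x + y b)) (δ (y b))))
      lem : ∀ bs → Σℚ (λ b → δ (inv (x + y b))) bs ℚ.- Σℚ (λ b → δ (inv (y b))) bs
            ≡ Σℚ (λ b → drop x (y b)) bs
      lem []       = ≡.refl
      lem (b ∷ bs) = ≡.trans
        (≡.cong ((p ℚ.+ P′) ℚ.+_) (ℚ.neg-distrib-+ h H′))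
        (≡.trans (ℚ-interchange p P′ (ℚ.- h) (ℚ.- H′)) (≡.cong₂ ℚ._+_ (step b) (lem bs)))
        where
        p = δ (inv (x + y b))
        h = δ (inv (y b))
        P′ = Σℚ (λ b → δ (inv (x + y b))) bs
        H′ = Σℚ (λ b → δ (inv (y b))) bs

    -- Deleting from `bad` each negative summand as it occurs shows that the
    -- bound does not depend on the length of the sum.
    Σℚ-bound : ∀ (g : Carrier → ℚ) → (∀ {x y} → x ≈ y → g x ≡ g y) →
      ∀ bad as → AllPairs (λ a b → y a ≉ y b) as →
      (∀ {a} → a ∈ as → 0ℚ ℚ.≤ g (y a) ⊎ Any (y a ≈_) bad) →
      ℚ.- Σℚ (λ x → ℚ.∣ g x ∣) bad ℚ.≤ Σℚ (λ a → g (y a)) as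
    Σℚ-bound g g-cong bad as distinct h = go bad as distinct h
      where
      T = Σℚ (λ x → ℚ.∣ g x ∣)

      0≤T : ∀ xs → 0ℚ ℚ.≤ T xs
      0≤T []       = ℚ.≤-refl
      0≤T (x ∷ xs) = ℚ.+-mono-≤ (ℚ.0≤∣p∣ (g x)) (0≤T xs)

      -∣q∣≤q : ∀ q → ℚ.- ℚ.∣ q ∣ ℚ.≤ q
      -∣q∣≤q q with ℚ.≤-total 0ℚ q
      ... | inj₁ 0≤q = ℚ.≤-trans (ℚ.neg-antimono-≤ (ℚ.0≤∣p∣ q)) 0≤q
      ... | inj₂ q≤0 = ℚ.≤-reflexive (≡.trans (≡.cong ℚ.-_ (≡.trans (≡.sym (ℚ.∣-p∣≡∣p∣ q))
        (ℚ.0≤p⇒∣p∣≡p (ℚ.neg-antimono-≤ q≤0)))) (ℚ-neg-involutive q))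

      T-remove : ∀ {v} xs (p : Any (v ≈_) xs) → T xs ≡ ℚ.∣ g v ∣ ℚ.+ T (xs ─ p)
      T-remove (x ∷ xs) (here v≈x) = ≡.cong (λ q → ℚ.∣ q ∣ ℚ.+ T xs) (≡.sym (g-cong v≈x))
      T-remove (x ∷ xs) (there p)  = ≡.trans (≡.cong (ℚ.∣ g x ∣ ℚ.+_) (T-remove xs p))
        (ℚ-x∙yz≈y∙xz ℚ.∣ g x ∣ ℚ.∣ g _ ∣ (T (xs ─ p)))

      survives : ∀ {v w} xs (p : Any (v ≈_) xs) → v ≉ w → Any (w ≈_) xs → Any (w ≈_) (xs ─ p)
      survives (x ∷ xs) (here v≈x) v≉w (here w≈x) = contradiction (trans v≈x (sym w≈x)) v≉w
      survives (x ∷ xs) (here v≈x) v≉w (there r)  = r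
      survives (x ∷ xs) (there p)  v≉w (here w≈x) = here w≈x
      survives (x ∷ xs) (there p)  v≉w (there r)  = there (survives xs p v≉w r)

      go : ∀ bad as → AllPairs (λ a b → y a ≉ y b) as →
        (∀ {a} → a ∈ as → 0ℚ ℚ.≤ g (y a) ⊎ Any (y a ≈_) bad) →
        ℚ.- T bad ℚ.≤ Σℚ (λ a → g (y a)) as
      go bad []       _                 _ = ℚ.neg-antimono-≤ (0≤T bad)
      go bad (a ∷ as) (a≉as ∷ distinct) h with h (here ≡.refl)
      ... | inj₁ 0≤ga = ≡.subst (ℚ._≤ _) (ℚ.+-identityˡ _)
        (ℚ.+-mono-≤ 0≤ga (go bad as distinct (λ p → h (there p))))
      ... | inj₂ p = ≡.subst (ℚ._≤ _)
        (≡.sym (≡.trans (≡.cong ℚ.-_ (T-remove bad p)) (ℚ.neg-distrib-+ ℚ.∣ g (y a) ∣ _)))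
        (ℚ.+-mono-≤ (-∣q∣≤q (g (y a))) (go (bad ─ p) as distinct λ {b} b∈as →
          Sum.map₂ (survives bad p (All.lookup a≉as b∈as)) (h (there b∈as))))

-- Evaluation of polynomials

module Evaluation {c ℓ} (R : CommutativeRing c ℓ) where
  open CommutativeRing R
  open Polynomial R
  open import Algebra.Properties.Semiring.Exp semiring using (_^_)
  open import Algebra.Properties.Semiring.Sum semiring
    using (sum; sum-cong-≋; *-distribˡ-sum; sum-replicate-zero)
  open import Algebra.Properties.CommutativeSemigroup *-commutativeSemigroup using (x∙yz≈y∙xz)

  eval-[] : ∀ p x → p ≈ᴾ [] → eval p x ≈ 0#
  eval-[] []      x e = refl
  eval-[] (c ∷ p) x e = trans (+-cong (e 0) (*-congˡ (eval-[] p x (λ n → e (suc n)))))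
    (trans (+-identityˡ _) (zeroʳ x))

  eval-cong : ∀ p q x → p ≈ᴾ q → eval p x ≈ eval q x
  eval-cong []      q       x e = sym (eval-[] q x (λ n → sym (e n)))
  eval-cong (c ∷ p) []      x e = eval-[] (c ∷ p) x e
  eval-cong (c ∷ p) (d ∷ q) x e = +-cong (e 0) (*-congˡ (eval-cong p q x (λ n → e (suc n))))

  eval-sum : ∀ p x n → length p ℕ.≤ n → sum {n} (λ j → coeff p (toℕ j) * x ^ toℕ j) ≈ eval p x
  eval-sum []      x n       _          = trans (sum-cong-≋ {n} (λ j → zeroˡ _)) (sum-replicate-zero n)
  eval-sum (c ∷ p) x (suc n) (ℕ.s≤s le) = +-cong (*-identityʳ c)
    (trans (sum-cong-≋ {n} (λ j → x∙yz≈y∙xz _ _ _))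
      (trans (sym (*-distribˡ-sum x (λ (j : Fin n) → coeff p (toℕ j) * x ^ toℕ j)))
        (*-congˡ (eval-sum p x n le))))

  eval-∷ʳ : ∀ p c x → eval (p ∷ʳ c) x ≈ eval p x + c * x ^ length p
  eval-∷ʳ []      c x = trans (+-congˡ (zeroʳ x)) (trans (+-comm _ _) (+-congˡ (sym (*-identityʳ c))))
  eval-∷ʳ (d ∷ p) c x = trans
    (+-congˡ (trans (*-congˡ (eval-∷ʳ p c x)) (trans (distribˡ _ _ _) (+-congˡ (x∙yz≈y∙xz _ _ _)))))
    (sym (+-assoc _ _ _))

  -- Reversing coefficients gives x^(n-1) times the reversed polynomial at 1/x, where n is the
  -- length. The extra factor x on both sides avoids the exponent n-1, which makes no sense for the
  -- empty list.
  eval-reverse : ∀ p {x y} → x * y ≈ 1# → x ^ length p * eval (reverse p) y ≈ x * eval p x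
  eval-reverse []      {x}     xy≈1 = trans (zeroʳ _) (sym (zeroʳ x))
  eval-reverse (c ∷ p) {x} {y} xy≈1 = begin
    x ^ suc n * eval (reverse (c ∷ p)) y              ≡⟨ ≡.cong (λ p → x ^ suc n * eval p y)
                                                               (List.unfold-reverse c p) ⟩
    x ^ suc n * eval (reverse p ∷ʳ c) y               ≈⟨ *-congˡ (eval-∷ʳ (reverse p) c y) ⟩
    x ^ suc n * (eval (reverse p) y + c * y ^ length (reverse p))
                                                      ≡⟨ ≡.cong (λ m → x ^ suc n * (eval (reverse p) y + c * y ^ m))
                                                               (List.length-reverse p) ⟩
    x ^ suc n * (eval (reverse p) y + c * y ^ n)      ≈⟨ trans (*-assoc _ _ _) (*-congˡ (distribˡ _ _ _)) ⟩
    x * (x ^ n * eval (reverse p) y + x ^ n * (c * y ^ n))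
                                                      ≈⟨ *-congˡ (+-cong (eval-reverse p xy≈1) (x∙yz≈y∙xz _ _ _)) ⟩
    x * (x * eval p x + c * (x ^ n * y ^ n))          ≈⟨ *-congˡ (trans (+-comm _ _)
                                                           (+-congʳ (trans (*-congˡ (powers n)) (*-identityʳ c)))) ⟩
    x * (c + x * eval p x)                            ∎
    where
    open import Relation.Binary.Reasoning.Setoid setoid
    open import Algebra.Properties.CommutativeSemigroup *-commutativeSemigroup using (interchange)
    n = length p
    powers : ∀ n → x ^ n * y ^ n ≈ 1#
    powers zero    = *-identityˡ 1#
    powers (suc n) = trans (interchange _ _ _ _) (trans (*-cong xy≈1 (powers n)) (*-identityˡ 1#))

-- The embeddings of 𝔽_q and of A

module Extension {c ℓ q c′ ℓ′} {𝔽 : FiniteField c ℓ q} (E : ValuedExtension 𝔽 c′ ℓ′) where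
  private
    module 𝔽 = FiniteField 𝔽
    module A = Polynomial 𝔽.commutativeRing
    module 𝔽ₚ where
      open import Algebra.Properties.Ring 𝔽.ring public

  open ValuedExtension E
  open Valuation valuedField public
  open PartialFractions fld _≟_ public
  open Evaluation commutativeRing public
  open IsRingHomomorphism ι-hom
    using () renaming (⟦⟧-cong to ι-cong; +-homo to ι-+; *-homo to ι-*; 0#-homo to ι-0; 1#-homo to ι-1)
    public
  open import Algebra.Properties.Ring ring
  open Extrema (DecTotalOrder.totalOrder ℚ.≤-decTotalOrder) using (argmax; f[xs]≤f[argmax])

  open Inverse 𝔽.enumeration public using ()
    renaming (to to index; from to elem; to-cong to index-cong;
              strictlyInverseʳ to elem-index; strictlyInverseˡ to index-elem)

  elem-injective : ∀ {i j} → elem i 𝔽.≈ elem j → i ≡ j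
  elem-injective {i} {j} e = ≡.trans (≡.sym (index-elem i)) (≡.trans (index-cong e) (index-elem j))

  ι≉0 : ∀ {a} → a 𝔽.≉ 𝔽.0# → ι a ≉ 0#
  ι≉0 {a} a≉0 e = 1≉0 (trans (sym ι-1) (trans (ι-cong (𝔽.sym (𝔽.inverseʳ a a≉0)))
    (trans (ι-* a _) (trans (*-congʳ e) (zeroˡ _)))))

  _≟𝔽_ : Decidable 𝔽._≈_
  a ≟𝔽 b with index a Fin.≟ index b
  ... | yes e = yes (𝔽.trans (𝔽.sym (elem-index a)) (𝔽.trans (𝔽.reflexive (≡.cong elem e)) (elem-index b)))
  ... | no  n = no λ e → n (index-cong e)

  -- Multiplication by c cannot increase the degree of an element of 𝔽_q of
  -- maximal degree.
  δ-ι≤0 : ∀ {c} → c 𝔽.≉ 𝔽.0# → δ (ι c) ℚ.≤ 0ℚ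
  δ-ι≤0 {c} c≉0 = ℚ.≮⇒≥ λ 0<d → ℚ.<-irrefl ≡.refl (ℚ.<-≤-trans
    (≡.subst₂ ℚ._<_ (ℚ.+-identityˡ (f m)) (≡.sym (δ-ι-* 0<d)) (ℚ.+-monoˡ-< (f m) 0<d))
    (maximal (c 𝔽.* elem m)))
    where
    f : Fin q → ℚ
    f i = δ (ι (elem i))
    m : Fin q
    m = argmax f (index c) (allFin q)
    maximal : ∀ a → δ (ι a) ℚ.≤ f m
    maximal a = ≡.subst (ℚ._≤ f m) (δ-cong (ι-cong (elem-index a)))
      (All.lookup (f[xs]≤f[argmax] {f = f} (index c) (allFin q)) (∈-allFin (index a)))
    δ-ι-* : 0ℚ ℚ.< δ (ι c) → δ (ι (c 𝔽.* elem m)) ≡ δ (ι c) ℚ.+ f m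
    -- The maximizer is nonzero: the maximum is at least δ (ι c) > 0, whereas δ is 0 at 0.
    δ-ι-* 0<d = ≡.trans (δ-cong (ι-* c _)) (δ-* (ι≉0 c≉0) λ e →
      ℚ.<-irrefl ≡.refl (ℚ.<-≤-trans 0<d (≡.subst (δ (ι c) ℚ.≤_) (δ-0 e) (maximal c))))

  -- Both c and its inverse have degree at most 0, and the two degrees add up to 0.
  δ-ι : ∀ {c} → c 𝔽.≉ 𝔽.0# → δ (ι c) ≡ 0ℚ
  δ-ι {c} c≉0 = ℚ.≤-antisym (δ-ι≤0 c≉0) (ℚ.≤-trans (ℚ.≤-reflexive (≡.sym sum≡0))
    (≡.subst (δ (ι c) ℚ.+ δ (ι (c 𝔽.⁻¹)) ℚ.≤_) (ℚ.+-identityʳ _)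
      (ℚ.+-monoʳ-≤ (δ (ι c)) (δ-ι≤0 c⁻¹≉0))))
    where
    c⁻¹≉0 : c 𝔽.⁻¹ 𝔽.≉ 𝔽.0#
    c⁻¹≉0 e = 𝔽.1≉0 (𝔽.trans (𝔽.sym (𝔽.inverseʳ c c≉0)) (𝔽.trans (𝔽.*-congˡ e) (𝔽.zeroʳ c)))
    sum≡0 : δ (ι c) ℚ.+ δ (ι (c 𝔽.⁻¹)) ≡ 0ℚ
    sum≡0 = ≡.trans (≡.sym (δ-* (ι≉0 c≉0) (ι≉0 c⁻¹≉0)))
      (≡.trans (δ-cong (trans (sym (ι-* c _)) (trans (ι-cong (𝔽.inverseʳ c c≉0)) ι-1))) δ-1)

  -- Translation by 1 permutes 𝔽_q, so the sum of all elements equals itself plus q times 1. This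
  -- gives q = 0 without speaking of the characteristic.
  Σ-𝔽-1≈0 : Σ (λ _ → 1#) (allFin q) ≈ 0#
  Σ-𝔽-1≈0 = +-identityʳ-unique (Σ f (allFin q)) _ (begin
    Σ f (allFin q) + Σ (λ _ → 1#) (allFin q)  ≈⟨ Σ-+ f _ (allFin q) ⟨
    Σ (λ i → f i + 1#) (allFin q)             ≈⟨ Σ-cong (allFin q) (λ _ → f-σ _) ⟨
    Σ (λ i → f (σ i)) (allFin q)              ≈⟨ Σ-reindex f σ (Unique.allFin⁺ q) (Unique.allFin⁺ q)
      (λ _ _ e → elem-injective (𝔽ₚ.+-cancelʳ 𝔽.1# _ _ (index-injective e)))
      (λ _ → ∈-allFin _)
      (λ {j} _ → index (elem j 𝔽.- 𝔽.1#) , ∈-allFin _ , ≡.sym (≡.trans (index-cong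
         (𝔽.trans (𝔽.+-congʳ (elem-index _)) (𝔽ₚ.//-rightDividesˡ 𝔽.1# (elem j)))) (index-elem j))) ⟩
    Σ f (allFin q)                            ∎)
    where
    open import Relation.Binary.Reasoning.Setoid setoid
    f : Fin q → Carrier
    f i = ι (elem i)
    σ : Fin q → Fin q
    σ i = index (elem i 𝔽.+ 𝔽.1#)
    f-σ : ∀ i → f (σ i) ≈ f i + 1#
    f-σ i = trans (ι-cong (elem-index _)) (trans (ι-+ _ _) (+-congˡ ι-1))
    index-injective : ∀ {a b} → index a ≡ index b → a 𝔽.≈ b
    index-injective {a} {b} e =
      𝔽.trans (𝔽.sym (elem-index a)) (𝔽.trans (𝔽.reflexive (≡.cong elem e)) (elem-index b))

  ⟪_⟫ : A.Poly → Carrier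
  ⟪ a ⟫ = eval (map ι a) θ

  coeff-ι : ∀ a n → coeff (map ι a) n ≈ ι (A.coeff a n)
  coeff-ι []      n       = sym ι-0
  coeff-ι (c ∷ a) zero    = refl
  coeff-ι (c ∷ a) (suc n) = coeff-ι a n

  ⟪⟫-cong : ∀ a b → a A.≈ᴾ b → ⟪ a ⟫ ≈ ⟪ b ⟫
  ⟪⟫-cong a b e = eval-cong (map ι a) (map ι b) θ
    (λ n → trans (coeff-ι a n) (trans (ι-cong (e n)) (sym (coeff-ι b n))))

  θ≉0 : θ ≉ 0#
  θ≉0 e = contradiction (≡.trans (≡.sym deg-θ) (≡.trans (deg-cong e) deg-0)) λ ()

  -- The lower bound 0 feeds the induction: it gives θ * ⟪ a ⟫ positive degree, so this term
  -- dominates the constant coefficient c, of degree at most 0.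
  δ-⟪⟫ : ∀ a → a A.≈ᴾ [] ⊎ (⟪ a ⟫ ≉ 0# × 0ℚ ℚ.≤ δ ⟪ a ⟫)
  δ-⟪⟫ []      = inj₁ (λ _ → 𝔽.refl)
  δ-⟪⟫ (c ∷ a) with δ-⟪⟫ a | c ≟𝔽 𝔽.0#
  ... | inj₁ a≈0 | yes c≈0 = inj₁ λ { zero → c≈0 ; (suc n) → a≈0 n }
  ... | inj₁ a≈0 | no  c≉0 = inj₂ ((λ e → ι≉0 c≉0 (trans (sym ≈ιc) e)) ,
                                   ℚ.≤-reflexive (≡.sym (≡.trans (δ-cong ≈ιc) (δ-ι c≉0))))
    where
    ≈ιc : ι c + θ * ⟪ a ⟫ ≈ ι c
    ≈ιc = trans (+-congˡ (trans (*-congˡ (⟪⟫-cong a [] a≈0)) (zeroʳ θ))) (+-identityʳ _)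
  ... | inj₂ (a≉0 , 0≤a) | _ = inj₂
    ( (λ e → contradiction (≡.trans (≡.sym deg≡) (≡.trans (deg-cong e) deg-0)) λ ())
    , ≡.subst (0ℚ ℚ.≤_) (≡.sym (δ-deg deg≡)) (ℚ.<⇒≤ 0<δθa))
    where
    0<δθa : 0ℚ ℚ.< δ (θ * ⟪ a ⟫)
    0<δθa = ≡.subst (0ℚ ℚ.<_) (≡.sym (≡.trans (δ-* θ≉0 a≉0) (≡.cong (ℚ._+ δ ⟪ a ⟫) (δ-deg deg-θ))))
      (ℚ.+-mono-<-≤ {0ℚ} {1ℚ} {0ℚ} (ℚ.positive⁻¹ 1ℚ) 0≤a)
    deg-ιc : deg (ι c) ≤₋ [ 0ℚ ]
    deg-ιc with c ≟𝔽 𝔽.0#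
    ... | yes c≈0 = ≡.subst (_≤₋ [ 0ℚ ])
      (≡.sym (≡.trans (deg-cong (trans (ι-cong c≈0) ι-0)) deg-0)) (ℚ₋.⊥₋≤ _)
    ... | no  c≉0 = ℚ₋.≤₋-reflexive-≡ ℚ.≤-reflexive (≡.trans (deg-δ (ι≉0 c≉0)) (≡.cong [_] (δ-ι c≉0)))
    deg≡ : deg (ι c + θ * ⟪ a ⟫) ≡ [ δ (θ * ⟪ a ⟫) ]
    deg≡ = deg-+-strict deg-ιc (deg-δ (x*y≉0 θ≉0 a≉0)) 0<δθa

  ⟪⟫-injective-0 : ∀ a → ⟪ a ⟫ ≈ 0# → a A.≈ᴾ []
  ⟪⟫-injective-0 a e with δ-⟪⟫ a
  ... | inj₁ a≈0       = a≈0
  ... | inj₂ (a≉0 , _) = contradiction e a≉0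

  -- Digits are written from the top coefficient down, after a leading 0 which
  -- puts the top digit of a polynomial of length m in the place of θ^(m-1).
  ⟪⟫∈K∞ : ∀ a → ⟪ a ⟫ ∈K∞
  ⟪⟫∈K∞ a = length a , A.coeff digits , λ B → length digits , λ n le →
    ≡.subst (_≤₋ [ B ]) (≡.sym (≡.trans (deg-cong (x≈y⇒x∙y⁻¹≈ε (expansion n le))) deg-0)) (ℚ₋.⊥₋≤ _)
    where
    open import Relation.Binary.Reasoning.Setoid setoid
    digits = 𝔽.0# ∷ reverse a
    expansion : ∀ n → length digits ℕ.≤ n →
      θ ^ length a * sum {n} (λ j → ι (A.coeff digits (toℕ j)) * (θ ⁻¹) ^ toℕ j) ≈ ⟪ a ⟫
    expansion n le = begin
      θ ^ length a * sum {n} (λ j → ι (A.coeff digits (toℕ j)) * (θ ⁻¹) ^ toℕ j)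
        ≈⟨ *-congˡ (sum-cong-≋ {n} (λ j → *-congʳ (coeff-ι digits (toℕ j)))) ⟨
      θ ^ length a * sum {n} (λ j → coeff (map ι digits) (toℕ j) * (θ ⁻¹) ^ toℕ j)
        ≈⟨ *-congˡ (eval-sum (map ι digits) (θ ⁻¹) n
             (≡.subst (ℕ._≤ n) (≡.sym (List.length-map ι digits)) le)) ⟩
      θ ^ length a * (ι 𝔽.0# + θ ⁻¹ * eval (map ι (reverse a)) (θ ⁻¹))
        ≈⟨ *-congˡ (trans (+-congʳ ι-0) (+-identityˡ _)) ⟩
      θ ^ length a * (θ ⁻¹ * eval (map ι (reverse a)) (θ ⁻¹))
        ≡⟨ ≡.cong₂ (λ m p → θ ^ m * (θ ⁻¹ * eval p (θ ⁻¹)))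
             (≡.sym (List.length-map ι a)) (List.reverse-map ι a) ⟩
      θ ^ length (map ι a) * (θ ⁻¹ * eval (reverse (map ι a)) (θ ⁻¹))
        ≈⟨ x∙yz≈y∙xz _ _ _ ⟩
      θ ⁻¹ * (θ ^ length (map ι a) * eval (reverse (map ι a)) (θ ⁻¹))
        ≈⟨ *-congˡ (eval-reverse (map ι a) (inverseʳ θ θ≉0)) ⟩
      θ ⁻¹ * (θ * ⟪ a ⟫)
        ≈⟨ trans (sym (*-assoc _ _ _)) (trans (*-congʳ (trans (*-comm _ _) (inverseʳ θ θ≉0))) (*-identityˡ _)) ⟩
      ⟪ a ⟫ ∎
      where
      open import Algebra.Properties.Semiring.Sum semiring using (sum-cong-≋)
      open import Algebra.Properties.CommutativeSemigroup *-commutativeSemigroup using (x∙yz≈y∙xz)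

-- Finite 𝔽_q-spaces with a linear form

module FiniteSpace {c ℓ q c′ ℓ′} {𝔽 : FiniteField c ℓ q} (E : ValuedExtension 𝔽 c′ ℓ′) where
  private module 𝔽 = FiniteField 𝔽
  open ValuedExtension E
  open Extension E
  open import Algebra.Properties.Ring ring
  open import Relation.Binary.Reasoning.Setoid setoid

  ι-neg : ∀ a → ι (𝔽.- a) ≈ - ι a
  ι-neg a = +-inverseˡ-unique _ _ (trans (sym (ι-+ _ a)) (trans (ι-cong (𝔽.-‿inverseˡ a)) ι-0))

  -- Adding s fills the gap at j. Combined with `Σ-𝔽-1≈0`, this is the rule that 1 summed over 𝔽_q^×
  -- is -1.
  Σ-indicator : ∀ {i} {I : Set i} s {j} (f : I → Carrier) is → Unique is → j ∈ is →
    (f j ≈ 0#) → (∀ {i} → ¬ i ≡ j → f i ≈ s) → Σ f is + s ≈ Σ (λ _ → s) is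
  Σ-indicator s {j} f (j ∷ is) (j∉is ∷ _) (here ≡.refl) fj≈0 f≈s = begin
    (f j + Σ f is) + s      ≈⟨ +-congʳ (trans (+-congʳ fj≈0) (+-identityˡ _)) ⟩
    Σ f is + s              ≈⟨ +-comm _ _ ⟩
    s + Σ f is              ≈⟨ +-congˡ (Σ-cong is (λ i∈is → f≈s (λ i≡j → All.lookup j∉is i∈is (≡.sym i≡j)))) ⟩
    s + Σ (λ _ → s) is      ∎
  Σ-indicator s {j} f (i ∷ is) (i∉is ∷ unique) (there j∈is) fj≈0 f≈s = begin
    (f i + Σ f is) + s      ≈⟨ +-assoc _ _ _ ⟩
    f i + (Σ f is + s)      ≈⟨ +-cong (f≈s (All.lookup i∉is j∈is)) (Σ-indicator s f is unique j∈is fj≈0 f≈s) ⟩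
    s + Σ (λ _ → s) is      ∎

  -- An injective `val` compatible with both operations transports every identity in G from the
  -- field, so the vector space laws can be recovered from it. Propositional equality on G is what
  -- `Σ-reindex` works with.
  module LinearForm {g} {G : Set g} (elements : List G) (unique : Unique elements)
    (complete : ∀ v → v ∈ elements)
    (_⊕_ : G → G → G) (_⊙_ : 𝔽.Carrier → G → G) (φ : G → 𝔽.Carrier) (val : G → Carrier)
    (φ-⊕ : ∀ v w → φ (v ⊕ w) 𝔽.≈ φ v 𝔽.+ φ w)
    (φ-⊙ : ∀ a v → φ (a ⊙ v) 𝔽.≈ a 𝔽.* φ v)
    (val-⊕ : ∀ v w → val (v ⊕ w) ≈ val v + val w)
    (val-⊙ : ∀ a v → val (a ⊙ v) ≈ ι a * val v)
    (val-injective : ∀ {v w} → val v ≈ val w → v ≡ w)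
    (e : G) (φ-e : φ e 𝔽.≈ 𝔽.1#)
    where

    kernel : List G
    kernel = filter (λ v → φ v ≟𝔽 𝔽.0#) elements

    private
      W = kernel

      ∈W : ∀ {v} → φ v 𝔽.≈ 𝔽.0# → v ∈ W
      ∈W {v} = ∈-filter⁺ (λ v → φ v ≟𝔽 𝔽.0#) (complete v)

      φ-W : ∀ {w} → w ∈ W → φ w 𝔽.≈ 𝔽.0#
      φ-W w∈W = proj₂ (∈-filter⁻ (λ v → φ v ≟𝔽 𝔽.0#) {xs = elements} w∈W)

      unique-W : Unique W
      unique-W = Unique.filter⁺ (λ v → φ v ≟𝔽 𝔽.0#) unique

      ⊙∈W : ∀ a {w} → w ∈ W → a ⊙ w ∈ W
      ⊙∈W a w∈W = ∈W (𝔽.trans (φ-⊙ a _) (𝔽.trans (𝔽.*-congˡ (φ-W w∈W)) (𝔽.zeroʳ a)))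

      ⊕∈W : ∀ {v w} → v ∈ W → w ∈ W → v ⊕ w ∈ W
      ⊕∈W v∈W w∈W = ∈W (𝔽.trans (φ-⊕ _ _) (𝔽.trans (𝔽.+-cong (φ-W v∈W) (φ-W w∈W)) (𝔽.+-identityˡ _)))

      o : G
      o = 𝔽.0# ⊙ e

      val-o : val o ≈ 0#
      val-o = trans (val-⊙ _ e) (trans (*-congʳ ι-0) (zeroˡ _))

      φ-o : φ o 𝔽.≈ 𝔽.0#
      φ-o = 𝔽.trans (φ-⊙ _ e) (𝔽.zeroˡ _)

      -- The form φ separates e + w from the zero vector: its values there are 1 and 0.
      e+w≉0 : ∀ {w} → w ∈ W → val e + val w ≉ 0#
      e+w≉0 {w} w∈W e+w≈0 = 𝔽.1≉0 (𝔽.trans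
        (𝔽.sym (𝔽.trans (φ-⊕ e w) (𝔽.trans (𝔽.+-cong φ-e (φ-W w∈W)) (𝔽.+-identityʳ _))))
        (≡.subst (λ v → φ v 𝔽.≈ 𝔽.0#)
          (≡.sym (val-injective (trans (val-⊕ e w) (trans e+w≈0 (sym val-o))))) φ-o))

      ⊖ : G → G
      ⊖ v = (𝔽.- 𝔽.1#) ⊙ v

      val-⊖ : ∀ v → val (⊖ v) ≈ - val v
      val-⊖ v = trans (val-⊙ _ v) (trans (*-congʳ (trans (ι-neg 𝔽.1#) (-‿cong ι-1))) (-1*x≈-x _))

      S = Σ (λ w → inv (val e + val w)) W

    kernel-distinct : AllPairs (λ v w → val v ≉ val w) kernel
    kernel-distinct = AllPairs.map (λ v≢w v≈w → v≢w (val-injective v≈w)) unique-W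

    δ-Σ-kernel : S ≉ 0# × δ S ≡ Σℚ (λ w → drop (val e) (val w)) kernel
    -- `δ-Σ-inv` expects a list with a head; membership of the zero vector `o` shows that the kernel
    -- has one.
    δ-Σ-kernel = lem W (∈W φ-o) kernel-distinct (All.tabulate e+w≉0) const
      where
      lem : ∀ as → o ∈ as → AllPairs (λ v w → val v ≉ val w) as → All (λ w → val e + val w ≉ 0#) as →
        (∀ {b} → b ∈ as → Π (λ c → inv (val c - val b)) as ≈ Π (λ c → inv (val c)) as) →
        let s = Σ (λ w → inv (val e + val w)) as in
        s ≉ 0# × δ s ≡ Σℚ (λ w → drop (val e) (val w)) as
      lem (a ∷ as) _ = δ-Σ-inv val (val e) a as

      const : ∀ {b} → b ∈ W → Π (λ c → inv (val c - val b)) W ≈ Π (λ c → inv (val c)) W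
      -- Translation by -b permutes the kernel.
      const {b} b∈W = trans
        (Π-cong W (λ {v} _ → inv-cong (sym (trans (val-⊕ v (⊖ b)) (+-congˡ (val-⊖ b))))))
        (Π-reindex (λ v → inv (val v)) (_⊕ ⊖ b) unique-W unique-W
          (λ {v} {w} _ _ v-b≡w-b → val-injective (+-cancelʳ (val (⊖ b)) _ _
            (trans (sym (val-⊕ v _)) (trans (reflexive (≡.cong val v-b≡w-b)) (val-⊕ w _)))))
          (λ v∈W → ⊕∈W v∈W (⊙∈W _ b∈W))
          (λ {v} v∈W → v ⊕ b , ⊕∈W v∈W b∈W , val-injective (sym (begin
            val ((v ⊕ b) ⊕ ⊖ b)      ≈⟨ trans (val-⊕ _ _) (+-cong (val-⊕ v b) (val-⊖ b)) ⟩
            (val v + val b) - val b  ≈⟨ //-rightDividesʳ (val b) (val v) ⟩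
            val v                    ∎))))

    -- Each v is uniquely c e + w with c = φ v and w in the kernel, which splits the sum into one
    -- class for each c. The zero vector may take part: its default `inv` value 1 is multiplied by φ
    -- = 0.
    Σ-φ-inv : Σ (λ v → ι (φ v) * inv (val v)) elements ≈ - S
    Σ-φ-inv = begin
      Σ f elements
        ≈⟨ Σ-reindex f σ (Unique.cartesianProduct⁺ (Unique.allFin⁺ q) unique-W) unique
             σ-injective (λ _ → complete _) σ-onto ⟨
      Σ (λ p → f (σ p)) (cartesianProduct (allFin q) W)
        ≈⟨ Σ-× (λ i w → f (σ (i , w))) (allFin q) W ⟩
      Σ (λ i → Σ (λ w → f (σ (i , w))) W) (allFin q)
        ≈⟨ +-inverseˡ-unique _ _ (trans
             (Σ-indicator S _ (allFin q) (Unique.allFin⁺ q) (∈-allFin (index 𝔽.0#)) zero-class nonzero-class)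
             (trans (Σ-cong (allFin q) (λ _ → sym (*-identityʳ S)))
               (trans (Σ-*ˡ S (λ _ → 1#) (allFin q)) (trans (*-congˡ Σ-𝔽-1≈0) (zeroʳ S))))) ⟩
      - S ∎
      where
      f : G → Carrier
      f v = ι (φ v) * inv (val v)

      σ : Fin q × G → G
      σ (i , w) = (elem i ⊙ e) ⊕ w

      φ-σ : ∀ i {w} → w ∈ W → φ (σ (i , w)) 𝔽.≈ elem i
      φ-σ i w∈W = 𝔽.trans (φ-⊕ _ _) (𝔽.trans
        (𝔽.+-cong (𝔽.trans (φ-⊙ _ e) (𝔽.trans (𝔽.*-congˡ φ-e) (𝔽.*-identityʳ _))) (φ-W w∈W))
        (𝔽.+-identityʳ _))

      val-σ : ∀ i w → val (σ (i , w)) ≈ ι (elem i) * val e + val w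
      val-σ i w = trans (val-⊕ _ w) (+-congʳ (val-⊙ _ e))

      σ-injective : ∀ {x y} → x ∈ cartesianProduct (allFin q) W → y ∈ cartesianProduct (allFin q) W →
        σ x ≡ σ y → x ≡ y
      σ-injective {i , v} {j , w} x∈ y∈ eq = ≡.cong₂ _,_ i≡j (val-injective
        (+-cancelˡ (ι (elem i) * val e) _ _ (begin
        ι (elem i) * val e + val v  ≈⟨ val-σ i v ⟨
        val (σ (i , v))             ≡⟨ ≡.cong val eq ⟩
        val (σ (j , w))             ≈⟨ val-σ j w ⟩
        ι (elem j) * val e + val w  ≡⟨ ≡.cong (λ i → ι (elem i) * val e + val w) i≡j ⟨
        ι (elem i) * val e + val w  ∎)))
        where
        i≡j : i ≡ j
        i≡j = elem-injective (𝔽.trans (𝔽.sym (φ-σ i (proj₂ (∈-cartesianProduct⁻ (allFin q) W x∈))))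
          (𝔽.trans (𝔽.reflexive (≡.cong φ eq)) (φ-σ j (proj₂ (∈-cartesianProduct⁻ (allFin q) W y∈)))))

      σ-onto : ∀ {v} → v ∈ elements → ∃[ p ] p ∈ cartesianProduct (allFin q) W × v ≡ σ p
      σ-onto {v} _ = (index (φ v) , w) , ∈-cartesianProduct⁺ (∈-allFin _) (∈W φ-w≈0) , val-injective (sym (begin
        val (σ (index (φ v) , w))
          ≈⟨ val-σ _ w ⟩
        ι (elem (index (φ v))) * val e + val w
          ≈⟨ +-cong (*-congʳ (ι-cong (elem-index (φ v)))) (trans (val-⊕ _ v) (+-congʳ (val-⊙ _ e))) ⟩
        ι (φ v) * val e + (ι (𝔽.- φ v) * val e + val v)
          ≈⟨ +-congˡ (+-congʳ (trans (*-congʳ (ι-neg _)) (sym (-‿distribˡ-* _ _)))) ⟩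
        ι (φ v) * val e + (- (ι (φ v) * val e) + val v)
          ≈⟨ \\-leftDividesˡ (ι (φ v) * val e) (val v) ⟩
        val v ∎))
        where
        w = ((𝔽.- φ v) ⊙ e) ⊕ v
        φ-w≈0 : φ w 𝔽.≈ 𝔽.0#
        φ-w≈0 = 𝔽.trans (φ-⊕ _ v) (𝔽.trans
          (𝔽.+-congʳ (𝔽.trans (φ-⊙ _ e) (𝔽.trans (𝔽.*-congˡ φ-e) (𝔽.*-identityʳ _))))
          (𝔽.-‿inverseˡ (φ v)))

      Σ-class : Fin q → Carrier
      Σ-class i = Σ (λ w → f (σ (i , w))) W

      zero-class : Σ-class (index 𝔽.0#) ≈ 0#
      zero-class = trans (Σ-cong W (λ w∈W → trans
        (*-congʳ (trans (ι-cong (𝔽.trans (φ-σ _ w∈W) (elem-index 𝔽.0#))) ι-0)) (zeroˡ _))) (Σ-0 W)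

      -- With c the scalar `a`, replacing w by c w within the kernel cancels the scalar: c/(c e + c
      -- w) = 1/(e + w).
      nonzero-class : ∀ {i} → ¬ i ≡ index 𝔽.0# → Σ-class i ≈ S
      nonzero-class {i} i≢0 = begin
        Σ (λ w → f (σ (i , w))) W        ≈⟨ Σ-reindex (λ w → f (σ (i , w))) (a ⊙_) unique-W unique-W
          (λ {v} {w} _ _ av≡aw → val-injective (cancelˡ (ι≉0 a≉0)
            (trans (sym (val-⊙ a v)) (trans (reflexive (≡.cong val av≡aw)) (val-⊙ a w)))))
          (⊙∈W a)
          (λ {v} v∈W → (a 𝔽.⁻¹) ⊙ v , ⊙∈W _ v∈W , val-injective (sym (begin
            val (a ⊙ ((a 𝔽.⁻¹) ⊙ v))     ≈⟨ trans (val-⊙ a _) (*-congˡ (val-⊙ _ v)) ⟩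
            ι a * (ι (a 𝔽.⁻¹) * val v)   ≈⟨ *-assoc _ _ _ ⟨
            ι a * ι (a 𝔽.⁻¹) * val v     ≈⟨ *-congʳ (trans (sym (ι-* a _)) (trans (ι-cong (𝔽.inverseʳ a a≉0)) ι-1)) ⟩
            1# * val v                   ≈⟨ *-identityˡ _ ⟩
            val v                        ∎))) ⟨
        Σ (λ w → f (σ (i , a ⊙ w))) W    ≈⟨ Σ-cong W homogeneous ⟩
        S                                ∎
        where
        a = elem i
        a≉0 : a 𝔽.≉ 𝔽.0#
        a≉0 a≈0 = i≢0 (≡.trans (≡.sym (index-elem i)) (index-cong a≈0))
        homogeneous : ∀ {w} → w ∈ W → f (σ (i , a ⊙ w)) ≈ inv (val e + val w)
        homogeneous {w} w∈W = begin
          ι (φ (σ (i , a ⊙ w))) * inv (val (σ (i , a ⊙ w)))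
            ≈⟨ *-cong (ι-cong (φ-σ i (⊙∈W a w∈W)))
                      (inv-cong (trans (val-σ i _) (trans (+-congˡ (val-⊙ a w)) (sym (distribˡ _ _ _))))) ⟩
          ι a * inv (ι a * (val e + val w))
            ≈⟨ *-congˡ (inv-* (ι≉0 a≉0) (e+w≉0 w∈W)) ⟩
          ι a * (inv (ι a) * inv (val e + val w))
            ≈⟨ trans (sym (*-assoc _ _ _)) (trans (*-congʳ (inv-inverseʳ (ι≉0 a≉0))) (*-identityˡ _)) ⟩
          inv (val e + val w) ∎

-- Enumeration of vectors and maxima of finite families

vecs : List A → ∀ n → List (Vec A n)
vecs xs zero    = [] ∷ []
vecs xs (suc n) = cartesianProductWith _∷_ xs (vecs xs n)

vecs-unique : ∀ {xs : List A} → Unique xs → ∀ n → Unique (vecs xs n)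
vecs-unique uxs zero    = [] ∷ []
vecs-unique uxs (suc n) = Unique.cartesianProductWith⁺ _∷_ Vec.∷-injective uxs (vecs-unique uxs n)

vecs-complete : ∀ {xs : List A} → (∀ x → x ∈ xs) → ∀ {n} (v : Vec A n) → v ∈ vecs xs n
vecs-complete all []      = here ≡.refl
vecs-complete all (x ∷ v) = ∈-cartesianProductWith⁺ _∷_ (all x) (vecs-complete all v)

lookup-ext : ∀ {n} {u v : Vec A n} → (∀ k → lookup u k ≡ lookup v k) → u ≡ v
lookup-ext e = Pointwise-≡⇒≡ (extensional⇒inductive (ext e))

maximum : ∀ {n} → Vector ℕ n → ℕ
maximum {zero}  f = 0
maximum {suc n} f = f zero ℕ.⊔ maximum (λ i → f (suc i))

≤-maximum : ∀ {n} (f : Vector ℕ n) i → f i ℕ.≤ maximum f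
≤-maximum f zero    = ℕ.m≤m⊔n _ _
≤-maximum f (suc i) = ℕ.≤-trans (≤-maximum (λ i → f (suc i)) i) (ℕ.m≤n⊔m _ _)

q-1<q : ∀ q → q ℚ.- 1ℚ ℚ.< q
q-1<q q = ≡.subst (q ℚ.- 1ℚ ℚ.<_) (ℚ.+-identityʳ q) (ℚ.+-monoʳ-< q {ℚ.- 1ℚ} {0ℚ} (ℚ.negative⁻¹ (ℚ.- 1ℚ)))

-- Boxes of polynomial vectors

module Lattice {c ℓ q c′ ℓ′} {𝔽 : FiniteField c ℓ q} (C : ℂ∞ 𝔽 c′ ℓ′) where
  private module 𝔽 = FiniteField 𝔽
  open ℂ∞ C
  open Eisenstein C
  open Extension extension
  open FiniteSpace extension
  open import Algebra.Properties.Ring ring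
  private module 𝔽ₚ where
    open import Algebra.Properties.Ring 𝔽.ring public
  open import Algebra.Properties.Semiring.Sum semiring
    using (sum-cong-≋; *-distribˡ-sum; ∑-distrib-+; sum-replicate-zero)
  open import Algebra.Properties.CommutativeSemigroup *-commutativeSemigroup using (x∙yz≈y∙xz)
  open import Algebra.Properties.CommutativeSemigroup +-commutativeSemigroup
    using () renaming (interchange to +-interchange)

  -- Fixed length and entries in `Fin q` make propositional equality agree with equality of
  -- polynomials, as reindexing requires; coefficient lists are only determined up to trailing
  -- zeros.
  Row : ℕ → Set
  Row = Vec (Fin q)

  addᴿ : ∀ {n} → Row n → Row n → Row n
  addᴿ = Vec.zipWith (λ i j → index (elem i 𝔽.+ elem j))

  scaleᴿ : ∀ {n} → 𝔽.Carrier → Row n → Row n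
  scaleᴿ a = Vec.map (λ i → index (a 𝔽.* elem i))

  polyᴿ : ∀ {n} → Row n → A.Poly
  polyᴿ []      = []
  polyᴿ (i ∷ u) = elem i ∷ polyᴿ u

  coeff-addᴿ : ∀ {n} (u v : Row n) m →
    A.coeff (polyᴿ (addᴿ u v)) m 𝔽.≈ A.coeff (polyᴿ u) m 𝔽.+ A.coeff (polyᴿ v) m
  coeff-addᴿ []      []      m       = 𝔽.sym (𝔽.+-identityˡ _)
  coeff-addᴿ (i ∷ u) (j ∷ v) zero    = elem-index _
  coeff-addᴿ (i ∷ u) (j ∷ v) (suc m) = coeff-addᴿ u v m

  coeff-scaleᴿ : ∀ {n} a (u : Row n) m →
    A.coeff (polyᴿ (scaleᴿ a u)) m 𝔽.≈ a 𝔽.* A.coeff (polyᴿ u) m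
  coeff-scaleᴿ a []      m       = 𝔽.sym (𝔽.zeroʳ a)
  coeff-scaleᴿ a (i ∷ u) zero    = elem-index _
  coeff-scaleᴿ a (i ∷ u) (suc m) = coeff-scaleᴿ a u m

  ⟪⟫-addᴿ : ∀ {n} (u v : Row n) → ⟪ polyᴿ (addᴿ u v) ⟫ ≈ ⟪ polyᴿ u ⟫ + ⟪ polyᴿ v ⟫
  ⟪⟫-addᴿ []      []      = sym (+-identityˡ _)
  ⟪⟫-addᴿ (i ∷ u) (j ∷ v) = trans
    (+-cong (trans (ι-cong (elem-index _)) (ι-+ _ _)) (trans (*-congˡ (⟪⟫-addᴿ u v)) (distribˡ _ _ _)))
    (+-interchange _ _ _ _)

  ⟪⟫-scaleᴿ : ∀ {n} a (u : Row n) → ⟪ polyᴿ (scaleᴿ a u) ⟫ ≈ ι a * ⟪ polyᴿ u ⟫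
  ⟪⟫-scaleᴿ a []      = sym (zeroʳ _)
  ⟪⟫-scaleᴿ a (i ∷ u) = trans
    (+-cong (trans (ι-cong (elem-index _)) (ι-* _ _)) (trans (*-congˡ (⟪⟫-scaleᴿ a u)) (x∙yz≈y∙xz _ _ _)))
    (sym (distribˡ _ _ _))

  polyᴿ-injective : ∀ {n} (u v : Row n) → polyᴿ u A.≈ᴾ polyᴿ v → u ≡ v
  polyᴿ-injective []      []      e = ≡.refl
  polyᴿ-injective (i ∷ u) (j ∷ v) e =
    ≡.cong₂ _∷_ (elem-injective (e 0)) (polyᴿ-injective u v (λ n → e (suc n)))

  rowᴾ : ∀ n → A.Poly → Row n
  rowᴾ zero    p       = []
  rowᴾ (suc n) []      = index 𝔽.0# ∷ rowᴾ n []
  rowᴾ (suc n) (c ∷ p) = index c ∷ rowᴾ n p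

  polyᴿ-rowᴾ : ∀ n p → length p ℕ.≤ n → polyᴿ (rowᴾ n p) A.≈ᴾ p
  polyᴿ-rowᴾ zero    []      _          m       = 𝔽.refl
  polyᴿ-rowᴾ (suc n) []      _          zero    = elem-index _
  polyᴿ-rowᴾ (suc n) []      _          (suc m) = polyᴿ-rowᴾ n [] ℕ.z≤n m
  polyᴿ-rowᴾ (suc n) (c ∷ p) _          zero    = elem-index _
  polyᴿ-rowᴾ (suc n) (c ∷ p) (ℕ.s≤s le) (suc m) = polyᴿ-rowᴾ n p le m

  module _ {r : ℕ} where

    Matrix : ℕ → Set
    Matrix n = Vec (Row n) r

    matrices : ∀ n → List (Matrix n)
    matrices n = vecs (vecs (allFin q) n) r

    matrices-unique : ∀ n → Unique (matrices n)
    matrices-unique n = vecs-unique (vecs-unique (Unique.allFin⁺ q) n) r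

    matrices-complete : ∀ {n} (v : Matrix n) → v ∈ matrices n
    matrices-complete = vecs-complete (vecs-complete ∈-allFin)

    poly : ∀ {n} → Matrix n → Vector A.Poly r
    poly v k = polyᴿ (lookup v k)

    matrix : ∀ n → Vector A.Poly r → Matrix n
    matrix n a = tabulate (λ k → rowᴾ n (a k))

    poly-matrix : ∀ n a → (∀ k → length (a k) ℕ.≤ n) → ∀ k → poly (matrix n a) k A.≈ᴾ a k
    poly-matrix n a le k rewrite Vec.lookup∘tabulate (λ k → rowᴾ n (a k)) k = polyᴿ-rowᴾ n (a k) (le k)

    _⊕_ : ∀ {n} → Matrix n → Matrix n → Matrix n
    _⊕_ = Vec.zipWith addᴿ

    _⊙_ : ∀ {n} → 𝔽.Carrier → Matrix n → Matrix n
    a ⊙ v = Vec.map (scaleᴿ a) v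

    coeff-⊕ : ∀ {n} (v w : Matrix n) k m →
      A.coeff (poly (v ⊕ w) k) m 𝔽.≈ A.coeff (poly v k) m 𝔽.+ A.coeff (poly w k) m
    coeff-⊕ v w k m rewrite Vec.lookup-zipWith addᴿ k v w = coeff-addᴿ (lookup v k) (lookup w k) m

    coeff-⊙ : ∀ {n} a (v : Matrix n) k m → A.coeff (poly (a ⊙ v) k) m 𝔽.≈ a 𝔽.* A.coeff (poly v k) m
    coeff-⊙ a v k m rewrite Vec.lookup-map k (scaleᴿ a) v = coeff-scaleᴿ a (lookup v k) m

    -- The lattice attached to a point of Ω

    module _ (ω : Ω r) where
      open Ω ω

      ∙-cong : ∀ a b → (∀ k → a k A.≈ᴾ b k) → ω ∙ a ≈ ω ∙ b
      ∙-cong a b e = sum-cong-≋ (λ k → *-congˡ (⟪⟫-cong (a k) (b k) (e k)))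

      ∙-[] : ω ∙ (λ _ → []) ≈ 0#
      ∙-[] = trans (sum-cong-≋ {r} (λ k → zeroʳ (z k))) (sum-replicate-zero r)

      -- Elements of A lie in K∞, so the linear independence of the entries of 𝒛 over K∞ applies to
      -- them.
      ∙-injective-0 : ∀ a → ω ∙ a ≈ 0# → ∀ k → a k A.≈ᴾ []
      ∙-injective-0 a e k = ⟪⟫-injective-0 (a k)
        (independent (λ k → ⟪ a k ⟫) (λ k → ⟪⟫∈K∞ (a k)) (trans (sum-cong-≋ {r} (λ k → *-comm _ _)) e) k)

      val : ∀ {n} → Matrix n → Carrier
      val v = ω ∙ poly v

      val-⊕ : ∀ {n} (v w : Matrix n) → val (v ⊕ w) ≈ val v + val w
      val-⊕ v w = trans (sum-cong-≋ {r} (λ k → trans (*-congˡ (row k)) (distribˡ _ _ _)))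
        (∑-distrib-+ (λ k → z k * ⟪ poly v k ⟫) (λ k → z k * ⟪ poly w k ⟫))
        where
        row : ∀ k → ⟪ poly (v ⊕ w) k ⟫ ≈ ⟪ poly v k ⟫ + ⟪ poly w k ⟫
        row k rewrite Vec.lookup-zipWith addᴿ k v w = ⟪⟫-addᴿ (lookup v k) (lookup w k)

      val-⊙ : ∀ {n} a (v : Matrix n) → val (a ⊙ v) ≈ ι a * val v
      val-⊙ a v = trans (sum-cong-≋ {r} (λ k → trans (*-congˡ (row k)) (x∙yz≈y∙xz _ _ _)))
        (sym (*-distribˡ-sum (ι a) (λ k → z k * ⟪ poly v k ⟫)))
        where
        row : ∀ k → ⟪ poly (a ⊙ v) k ⟫ ≈ ι a * ⟪ poly v k ⟫
        row k rewrite Vec.lookup-map k (scaleᴿ a) v = ⟪⟫-scaleᴿ a (lookup v k)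

      val-injective : ∀ {n} {v w : Matrix n} → val v ≈ val w → v ≡ w
      val-injective {v = v} {w} e = lookup-ext λ k →
        polyᴿ-injective (lookup v k) (lookup w k) λ m → 𝔽ₚ.x∙y⁻¹≈ε⇒x≈y _ _ (𝔽.trans
          (𝔽.sym (𝔽.trans (coeff-⊕ v u k m) (𝔽.+-congˡ (𝔽.trans (coeff-⊙ _ w k m) (𝔽ₚ.-1*x≈-x _)))))
          (∙-injective-0 (poly (v ⊕ u)) v-w≈0 k m))
        where
        u = (𝔽.- 𝔽.1#) ⊙ w
        v-w≈0 : val (v ⊕ u) ≈ 0#
        v-w≈0 = trans (val-⊕ v u) (trans
          (+-cong e (trans (val-⊙ _ w) (trans (*-congʳ (trans (ι-neg 𝔽.1#) (-‿cong ι-1))) (-1*x≈-x _))))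
          (-‿inverseʳ _))

      open Setoid (Aʳ∖0 r) using () renaming (Carrier to Nonzero; _≈_ to _≋_)

      ∙≉0 : ∀ ((a , _) : Nonzero) → ω ∙ a ≉ 0#
      ∙≉0 (a , a≉0) e = a≉0 (∙-injective-0 a e)

      poly≉0 : ∀ {n} (v : Matrix n) → val v ≉ 0# → ¬ (∀ k → poly v k A.≈ᴾ [])
      poly≉0 v v≉0 e = v≉0 (trans (∙-cong (poly v) (λ _ → []) e) ∙-[])

      -- The test on `val` both discards the zero matrix and supplies the proof of nonvanishing that
      -- an index of the series carries.
      nonzeros : ∀ {n} → List (Matrix n) → List Nonzero
      nonzeros []       = []
      nonzeros (v ∷ vs) with val v ≟ 0#
      ... | yes _   = nonzeros vs
      ... | no  v≉0 = (poly v , poly≉0 v v≉0) ∷ nonzeros vs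

      nonzeros-All : ∀ {n p} {P : Vector A.Poly r → Set p} (vs : List (Matrix n)) →
        All (λ v → P (poly v)) vs → All (λ a → P (proj₁ a)) (nonzeros vs)
      nonzeros-All []       []         = []
      nonzeros-All (v ∷ vs) (pv ∷ pvs) with val v ≟ 0#
      ... | yes _ = nonzeros-All vs pvs
      ... | no  _ = pv ∷ nonzeros-All vs pvs

      nonzeros-unique : ∀ {n} (vs : List (Matrix n)) → Unique vs →
        SetoidUnique.Unique (Aʳ∖0 r) (nonzeros vs)
      nonzeros-unique []       []           = []
      nonzeros-unique (v ∷ vs) (v∉vs ∷ uvs) with val v ≟ 0#
      ... | yes _ = nonzeros-unique vs uvs
      ... | no  _ = nonzeros-All vs
                      (All.map (λ {w} v≢w v≈w → v≢w (val-injective {v = v} {w} (∙-cong (poly v) (poly w) v≈w))) v∉vs)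
                  ∷ nonzeros-unique vs uvs

      ∈-nonzeros : ∀ {n} (a : Nonzero) (vs : List (Matrix n)) →
        Any (λ v → ∀ k → poly v k A.≈ᴾ proj₁ a k) vs → Any (a ≋_) (nonzeros vs)
      ∈-nonzeros a (v ∷ vs) p with val v ≟ 0#
      ∈-nonzeros a (v ∷ vs) (here v≈a) | yes v≈0 =
        contradiction (trans (sym (∙-cong (poly v) (proj₁ a) v≈a)) v≈0) (∙≉0 a)
      ∈-nonzeros a (v ∷ vs) (there p)  | yes _   = ∈-nonzeros a vs p
      ∈-nonzeros a (v ∷ vs) (here v≈a) | no  _   = here (λ k m → 𝔽.sym (v≈a k m))
      ∈-nonzeros a (v ∷ vs) (there p)  | no  _   = there (∈-nonzeros a vs p)

      lengths : List Nonzero → ℕ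
      lengths []            = 0
      lengths ((a , _) ∷ S) = maximum (λ k → length (a k)) ℕ.⊔ lengths S

      -- The boxes are cofinal among the finite index sets, so convergence of the net can be
      -- exploited on boxes.
      ∈-nonzeros-matrices : ∀ n S → lengths S ℕ.≤ n → ∀ {a} → Any (a ≋_) S → Any (a ≋_) (nonzeros (matrices n))
      ∈-nonzeros-matrices n (b ∷ S) le {a} (here a≈b) = ∈-nonzeros a (matrices n)
        (Any.map (λ { ≡.refl k m → 𝔽.trans (poly-matrix n (proj₁ b) bound k m) (𝔽.sym (a≈b k m)) })
          (matrices-complete (matrix n (proj₁ b))))
        where
        bound : ∀ k → length (proj₁ b k) ℕ.≤ n
        bound k = ℕ.≤-trans (≤-maximum (λ k → length (proj₁ b k)) k) (ℕ.m⊔n≤o⇒m≤o _ (lengths S) le)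
      ∈-nonzeros-matrices n (b ∷ S) le {a} (there p) =
        ∈-nonzeros-matrices n S (ℕ.m⊔n≤o⇒n≤o (maximum (λ k → length (proj₁ b k))) _ le) {a} p

      partialSum : Fin r → List Nonzero → 𝕋
      partialSum k S = foldr _+ᵀ_ 0ᵀ (map (term ω k) S)

      coeff-scale : ∀ x p m → coeff (scale x p) m ≈ x * coeff p m
      coeff-scale x []      m       = sym (zeroʳ x)
      coeff-scale x (c ∷ p) zero    = refl
      coeff-scale x (c ∷ p) (suc m) = coeff-scale x p m

      coeff-term : ∀ k (a : Nonzero) m → coeff (scale ((ω ∙ proj₁ a) ⁻¹) (χₜ (proj₁ a k))) m
                   ≈ ι (A.coeff (proj₁ a k) m) * inv (ω ∙ proj₁ a)
      coeff-term k a m = trans (coeff-scale _ (χₜ (proj₁ a k)) m)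
        (trans (*-cong (sym (reflexive (inv-⁻¹ (∙≉0 a)))) (coeff-ι (proj₁ a k) m)) (*-comm _ _))

      -- The right-hand sum ranges over the whole space, as the linear algebra wants. The zero
      -- matrix left out on the left contributes nothing there, its coefficients being 0.
      coeff-partialSum : ∀ {n} k (vs : List (Matrix n)) j m →
        coeff (𝕋.seq (partialSum k (nonzeros vs)) j) m ≈
        Σ (λ v → ι (A.coeff (poly v k) m) * inv (val v)) vs
      coeff-partialSum k []       j m = refl
      coeff-partialSum k (v ∷ vs) j m with val v ≟ 0#
      ... | yes v≈0 = trans (coeff-partialSum k vs j m) (trans (sym (+-identityˡ _))
        (+-congʳ (sym (trans (*-congʳ (trans (ι-cong (∙-injective-0 (poly v) v≈0 k m)) ι-0)) (zeroˡ _)))))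
      ... | no  v≉0 = trans (coeff-+ (scale ((val v) ⁻¹) (χₜ (poly v k))) _ m)
        (+-cong (trans (coeff-scale _ (χₜ (poly v k)) m) (trans (*-congˡ (coeff-ι (poly v k) m)) (*-comm _ _)))
                (coeff-partialSum k vs j m))

      -- Adjoining one more index to a large finite set changes the partial sum
      -- by a single term, which is therefore small.
      term-small : ∀ {E} → E Is𝓔₁At ω → ∀ k (B : ℚ) → ∃[ N ] ∀ n → N ℕ.≤ n → ∀ (a : Nonzero) →
        ¬ Any (a ≋_) (nonzeros (matrices n)) →
        ∀ m → deg (ι (A.coeff (proj₁ a k) m) * inv (ω ∙ proj₁ a)) ≤₋ [ B ]
      term-small {E} isE k B = lengths S , λ n le a a∉ m →
        let V = nonzeros (matrices n)
            unique = nonzeros-unique (matrices n) (matrices-unique n)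
            (M₁ , f₁) = close V unique (λ {b} → ∈-nonzeros-matrices n S le {b})
            (M₂ , f₂) = close (a ∷ V) (All.¬Any⇒All¬ V a∉ ∷ unique)
                          (λ {b} p → there (∈-nonzeros-matrices n S le {b} p))
            M = M₁ ℕ.⊔ M₂
            x = 𝕋.seq (E k) M
            y = 𝕋.seq (partialSum k V) M
            t = scale ((ω ∙ proj₁ a) ⁻¹) (χₜ (proj₁ a k))
            x-y≤B = f₁ M (ℕ.m≤m⊔n M₁ M₂) m
            x-[t+y]≤B = f₂ M (ℕ.m≤n⊔m M₁ M₂) m
        in ≡.subst (_≤₋ [ B ]) (deg-cong (trans
             (-‿cong₂ (coeff-- x y m) (trans (coeff-- x (t +ᴾ y) m) (+-congˡ (-‿cong (coeff-+ t y m)))))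
             (trans ([x-y]-[x-[t+y]] _ _ _) (coeff-term k a m))))
             (deg-- x-y≤B x-[t+y]≤B)
        where
        S = proj₁ (isE k B)
        close = proj₂ (isE k B)
        -‿cong₂ : ∀ {x x′ y y′} → x ≈ x′ → y ≈ y′ → x - y ≈ x′ - y′
        -‿cong₂ e f = +-cong e (-‿cong f)
        [x-y]-[x-[t+y]] : ∀ x y t → (x - y) - (x - (t + y)) ≈ t
        [x-y]-[x-[t+y]] x y t = begin
          (x - y) - (x - (t + y))      ≈⟨ +-congˡ (⁻¹-anti-homo‿- x (t + y)) ⟩
          (x - y) + ((t + y) - x)      ≈⟨ +-comm _ _ ⟩
          ((t + y) - x) + (x - y)      ≈⟨ +-assoc _ _ _ ⟩
          (t + y) + (- x + (x - y))    ≈⟨ +-congˡ (\\-leftDividesʳ x (- y)) ⟩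
          (t + y) - y                  ≈⟨ //-rightDividesʳ y t ⟩
          t                            ∎
          where open import Relation.Binary.Reasoning.Setoid setoid

      -- A nonzero coefficient of an entry a k has absolute value 1, so the k-th term at a has a
      -- coefficient of absolute value 1/|𝒛𝒂| ≥ q^(-b). Outside a large box it would be at most q^β
      -- with β = - b - 1. As k is not known beforehand, the box must serve all coordinates, hence
      -- the maximum.
      finitely-many-small : ∀ {E} → E Is𝓔₁At ω → ∀ (b : ℚ) → ∃[ n ] ∀ (a : Nonzero) →
        deg (ω ∙ proj₁ a) ≤₋ [ b ] → Any (λ (v : Matrix n) → ω ∙ proj₁ a ≈ val v) (matrices n)
      finitely-many-small {E} isE b = n , small
        where
        β = ℚ.- b ℚ.- 1ℚ
        N = λ k → proj₁ (term-small {E} isE k β)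
        n = maximum N
        small : ∀ (a : Nonzero) → deg (ω ∙ proj₁ a) ≤₋ [ b ] →
          Any (λ (v : Matrix n) → ω ∙ proj₁ a ≈ val v) (matrices n)
        small (a , a≉0) a≤b with any? (λ (v : Matrix n) → ω ∙ a ≟ val v) (matrices n)
        ... | yes p = p
        ... | no ¬p = contradiction coeffs≈0 a≉0
          where
          val∈ : ∀ vs → Any ((a , a≉0) ≋_) (nonzeros vs) → Any (λ (v : Matrix n) → ω ∙ a ≈ val v) vs
          val∈ (v ∷ vs) p with val v ≟ 0#
          val∈ (v ∷ vs) p          | yes _ = there (val∈ vs p)
          val∈ (v ∷ vs) (here a≈v) | no  _ = here (∙-cong a (poly v) a≈v)
          val∈ (v ∷ vs) (there p)  | no  _ = there (val∈ vs p)

          coeffs≈0 : ∀ k → a k A.≈ᴾ []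
          coeffs≈0 k m with A.coeff (a k) m ≟𝔽 𝔽.0#
          ... | yes e = e
          ... | no ≉0 = contradiction
            (ℚ.<-≤-trans -b-1<-b (ℚ.≤-trans (ℚ.neg-antimono-≤ (δ-≤ (∙≉0 (a , a≉0)) a≤b))
              (≡.subst (ℚ._≤ β) (≡.trans (δ-* (ι≉0 ≉0) (inv≉0 _)) (≡.trans
                (≡.cong₂ ℚ._+_ (δ-ι ≉0) (δ-inv (ω ∙ a))) (ℚ.+-identityˡ _)))
                (δ-≤ (x*y≉0 (ι≉0 ≉0) (inv≉0 _))
                  (proj₂ (term-small {E} isE k β) n (≤-maximum N k) (a , a≉0) (λ p → ¬p (val∈ (matrices n) p)) m)))))
            (ℚ.<-irrefl ≡.refl)
            where
            -b-1<-b : β ℚ.< ℚ.- b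
            -b-1<-b = q-1<q (ℚ.- b)

      -- Nonvanishing of a single coordinate

      module _ (i : Fin r) where

        unit : Vector A.Poly r
        unit k with k Fin.≟ i
        ... | yes _ = 𝔽.1# ∷ []
        ... | no  _ = []

        unit-length : ∀ n k → length (unit k) ℕ.≤ suc n
        unit-length n k with k Fin.≟ i
        ... | yes _ = ℕ.s≤s ℕ.z≤n
        ... | no  _ = ℕ.z≤n

        unit-1 : A.coeff (unit i) 0 𝔽.≈ 𝔽.1#
        unit-1 with i Fin.≟ i
        ... | yes _   = 𝔽.refl
        ... | no  i≢i = contradiction ≡.refl i≢i

        ε≉0 : ∀ {E} → E Is𝓔₁At ω → E i ≉ᵀ 0ᵀ
        ε≉0 {E} isE E≈0 = ℚ.<-irrefl ≡.refl (ℚ.<-≤-trans (q-1<q D)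
          (ℚ.≤-trans lower (δ-≤ (proj₁ δ-Σ-kernel) upper)))
          where
          x = ω ∙ unit
          n₀ = proj₁ (finitely-many-small {E} isE (δ x))
          -- The value 0 is listed separately, since `finitely-many-small` speaks of nonzero indices
          -- and `drop x` at 0 may be negative.
          bad = 0# ∷ map val (matrices n₀)
          D = ℚ.- Σℚ (λ y → ℚ.∣ drop x y ∣) bad
          β = D ℚ.- 1ℚ
          S = proj₁ (isE i β)
          -- The successor makes room for the entry 1 of the unit vector, a list of length 1, even
          -- when `lengths S` is 0.
          n = suc (lengths S)

          φ : Matrix n → 𝔽.Carrier
          φ v = A.coeff (poly v i) 0

          e : Matrix n
          e = matrix n unit

          poly-e : ∀ k → poly e k A.≈ᴾ unit k
          poly-e = poly-matrix n unit (unit-length _)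

          val-e : val e ≈ x
          val-e = ∙-cong (poly e) unit poly-e

          φ-e : φ e 𝔽.≈ 𝔽.1#
          φ-e = 𝔽.trans (poly-e i 0) unit-1

          open LinearForm (matrices n) (matrices-unique n) matrices-complete _⊕_ _⊙_ φ val
            (λ v w → coeff-⊕ v w i 0) (λ a v → coeff-⊙ a v i 0) val-⊕ val-⊙ val-injective e φ-e

          s = Σ (λ w → inv (val e + val w)) kernel

          upper : deg s ≤₋ [ β ]
          -- Both the partial sum and 0 lie within q^β of E i. Subtracting the two differences
          -- leaves minus the partial sum, whose constant coefficient is -(-s) = s.
          upper =
            let (M₁ , f₁) = proj₂ (isE i β) (nonzeros (matrices n))
                              (nonzeros-unique (matrices n) (matrices-unique n))
                              (λ {b} → ∈-nonzeros-matrices n S (ℕ.n≤1+n _) {b})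
                (M₂ , f₂) = E≈0 β
                M = M₁ ℕ.⊔ M₂
                p = 𝕋.seq (E i) M
                t = 𝕋.seq (partialSum i (nonzeros (matrices n))) M
            in ≡.subst (_≤₋ [ β ]) (deg-cong (trans
                 (+-cong (coeff-- p t 0) (-‿cong (trans (coeff-- p [] 0) (trans (+-congˡ -0#≈0#) (+-identityʳ _)))))
                 (trans (trans (+-congʳ (+-comm _ _)) (//-rightDividesʳ (coeff p 0) _))
                   (trans (-‿cong (trans (coeff-partialSum i (matrices n) M 0) Σ-φ-inv)) (-‿involutive s)))))
                 (deg-- (f₁ M (ℕ.m≤m⊔n M₁ M₂) 0) (f₂ M (ℕ.m≤n⊔m M₁ M₂) 0))

          large-or-bad : ∀ w → 0ℚ ℚ.≤ drop x (val w) ⊎ Any (val w ≈_) bad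
          large-or-bad w with val w ≟ 0# | ℚ₋.≤₋-dec ℚ._≤?_ (deg (val w)) [ δ x ]
          ... | yes w≈0 | _       = inj₂ (here w≈0)
          ... | no  w≉0 | no  w≰x = inj₁ (ℚ.≤-reflexive (≡.sym (drop-large w≉0 w≰x)))
          ... | no  w≉0 | yes w≤x = inj₂ (there (Any.map⁺
            (proj₂ (finitely-many-small {E} isE (δ x)) (poly w , poly≉0 w w≉0) w≤x)))

          lower : D ℚ.≤ δ s
          lower = ℚ.≤-trans
            (Σℚ-bound val (drop x) drop-cong bad kernel
              kernel-distinct
              (λ {w} _ → large-or-bad w))
            (ℚ.≤-reflexive (≡.trans
              (Σℚ-cong kernel (λ {w} _ → ≡.cong (λ d → δ (val w) ℚ.- d) (δ-cong (+-congʳ (sym val-e)))))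
              (≡.sym (proj₂ δ-Σ-kernel))))

corollary4p6 : ∀ {c ℓ c′ ℓ′ : Level} {q : ℕ} (𝔽 : FiniteField c ℓ q) (C : ℂ∞ 𝔽 c′ ℓ′) →
    let open Eisenstein C in
    (r : ℕ) → 2 ≤ r → (ω : Ω r) (E : Vector 𝕋 r) → E Is𝓔₁At ω →
    (∀ i → E i ≉ᵀ 0ᵀ) × ¬ (∀ i → E i ≈ᵀ 0ᵀ)
corollary4p6 𝔽 C r 2≤r ω E isE = nonzero , λ E≈0 → nonzero i (E≈0 i)
  where
  nonzero = λ i → Lattice.ε≉0 C ω i {E} isE
  -- One coordinate refutes the vanishing of the vector; this is the one with subscript 1.
  i = fromℕ< (ℕ.<⇒≤ 2≤r)
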